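{- Let $R$ be a finite local Frobenius ring with a fixed primitive additive character $\psi$. Let $\tau$ be any multiplicative character of $R$ and let $\chi$ be a primitive multiplicative character of $R$. Then $$\sum_{a\in R^\times}\chi(a)\,|K_\tau(a)|^2=\tau(-1)\,J(\chi\tau,\chi\overline{\tau})\,G(\chi)^2.$$
   Context: All rings are finite and commutative with identity; $R^\times$ is the unit group; $M$ is the maximal ideal. An additive character $(R,+)\to\mathbb{C}^*$ is primitive if the only ideal on which it is identically $1$ is $(0)$; $R$ is Frobenius if such a character exists. A multiplicative character is a homomorphism $R^\times\to\mathbb{C}^*$; its conductor is $R$ if it is trivial, and otherwise the largest ideal $I\subseteq M$ such that it is identically $1$ on $1+I$; it is primitive if its conductor is $(0)$. $K_\tau(a)=\sum_{u\in R^\times}\tau(u)\psi(u+au^{ -1})$; Gauss sum $G(\chi)=\sum_{u\in R^\times}\psi(u)\chi(u)$; Jacobi sum $J(\chi,\eta)=\sum_{u,v\in R^\times,\,u+v=1}\chi(u)\eta(v)$; $\overline{\tau}$ is the complex conjugate (inverse) character. -}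

module Defs where

open import Algebra.Bundles using (AbelianGroup; CommutativeRing)
open import Algebra.Bundles.Raw using (RawGroup)
open import Algebra.Definitions using (Invertible)
open import Algebra.Morphism.Bundles using (GroupHomomorphism)
import Algebra.Morphism.Construct.Composition as Composition
open import Algebra.Morphism.Structures using (IsGroupHomomorphism)
import Algebra.Properties.CommutativeSemigroup as CommutativeSemigroupProperties
import Algebra.Properties.Ring as RingProperties
import Algebra.Properties.Semiring.Sum as SemiringSum
open import Data.Bool.Base using (if_then_else_)
open import Data.Fin.Base using (Fin)
open import Data.Fin.Properties using (any?) renaming (_≟_ to _≟ᶠ_)
open import Data.Nat.Base as ℕ using (ℕ)
import Data.Nat.Properties as ℕ
open import Data.Product.Base using (Σ; ∃-syntax; _×_; _,_; proj₁; proj₂)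
open import Data.Rational.Base as ℚ using (ℚ; 0ℚ; 1ℚ; ½)
import Data.Rational.Properties as ℚ
open import Data.Rational.Solver using (module +-*-Solver)
open import Function.Bundles using (Inverse)
open import Level using (Level; 0ℓ; suc; _⊔_; Lift; lift)
open import Relation.Binary.Bundles using (Setoid)
open import Relation.Binary.Definitions using (Decidable)
open import Relation.Binary.PropositionalEquality as ≡ using (_≡_)
open import Relation.Binary.Structures using (IsEquivalence)
open import Relation.Nullary using (¬_; Dec; yes; no; does)
open import Relation.Nullary.Decidable using (map′)
open import Relation.Unary using (Pred; _∈_; _⊆_; _≐_)

private
  variable
    c ℓ : Level

-- The real numbers are Cauchy sequences of rationals (with a modulus of
-- convergence); two of them are equal when their difference tends to 0.
-- All operations are pointwise.

private
  2-½ : ∀ ε → ½ ℚ.* ε ℚ.+ ½ ℚ.* ε ≡ ε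
  2-½ ε = ≡.trans (≡.sym (ℚ.*-distribʳ-+ ε ½ ½)) (ℚ.*-identityˡ ε)

  ½-pos : ∀ {ε} → 0ℚ ℚ.< ε → 0ℚ ℚ.< ½ ℚ.* ε
  ½-pos {ε} 0<ε =
    ≡.subst (ℚ._< ½ ℚ.* ε) (ℚ.*-zeroʳ ½) (ℚ.*-monoʳ-<-pos ½ 0<ε)

  self-close : ∀ p {ε} → 0ℚ ℚ.< ε → ℚ.∣ p ℚ.- p ∣ ℚ.< ε
  self-close p {ε} 0<ε =
    ≡.subst (λ r → ℚ.∣ r ∣ ℚ.< ε) (≡.sym (ℚ.+-inverseʳ p)) 0<ε

  swap-close : ∀ p q {ε} → ℚ.∣ p ℚ.- q ∣ ℚ.< ε → ℚ.∣ q ℚ.- p ∣ ℚ.< ε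
  swap-close p q {ε} = ≡.subst (ℚ._< ε) (≡.trans (≡.sym (ℚ.∣-p∣≡∣p∣ (p ℚ.- q)))
    (≡.cong ℚ.∣_∣ (solve′ p q)))
    where
    open +-*-Solver
    solve′ : ∀ p q → ℚ.- (p ℚ.- q) ≡ q ℚ.- p
    solve′ = +-*-Solver.solve 2 (λ p q → :- (p :- q) := q :- p) ≡.refl

  sum-close : ∀ p q {ε} → ℚ.∣ p ∣ ℚ.< ½ ℚ.* ε → ℚ.∣ q ∣ ℚ.< ½ ℚ.* ε →
              ℚ.∣ p ℚ.+ q ∣ ℚ.< ε
  sum-close p q {ε} p< q< = ℚ.≤-<-trans (ℚ.∣p+q∣≤∣p∣+∣q∣ p q)
    (≡.subst (ℚ.∣ p ∣ ℚ.+ ℚ.∣ q ∣ ℚ.<_) (2-½ ε) (ℚ.+-mono-< p< q<))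

  +-close : ∀ p p′ q q′ {ε} → ℚ.∣ p ℚ.- p′ ∣ ℚ.< ½ ℚ.* ε → ℚ.∣ q ℚ.- q′ ∣ ℚ.< ½ ℚ.* ε →
            ℚ.∣ (p ℚ.+ q) ℚ.- (p′ ℚ.+ q′) ∣ ℚ.< ε
  +-close p p′ q q′ {ε} p< q< = ≡.subst (λ r → ℚ.∣ r ∣ ℚ.< ε) (eq p p′ q q′)
    (sum-close (p ℚ.- p′) (q ℚ.- q′) p< q<)
    where
    open +-*-Solver
    eq : ∀ p p′ q q′ → (p ℚ.- p′) ℚ.+ (q ℚ.- q′) ≡ (p ℚ.+ q) ℚ.- (p′ ℚ.+ q′)
    eq = +-*-Solver.solve 4
      (λ p p′ q q′ → (p :- p′) :+ (q :- q′) := (p :+ q) :- (p′ :+ q′)) ≡.refl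

  trans-close : ∀ p q r {ε} → ℚ.∣ p ℚ.- q ∣ ℚ.< ½ ℚ.* ε → ℚ.∣ q ℚ.- r ∣ ℚ.< ½ ℚ.* ε →
                ℚ.∣ p ℚ.- r ∣ ℚ.< ε
  trans-close p q r {ε} p< q< = ≡.subst (λ s → ℚ.∣ s ∣ ℚ.< ε) (eq p q r)
    (sum-close (p ℚ.- q) (q ℚ.- r) p< q<)
    where
    open +-*-Solver
    eq : ∀ p q r → (p ℚ.- q) ℚ.+ (q ℚ.- r) ≡ p ℚ.- r
    eq = +-*-Solver.solve 3 (λ p q r → (p :- q) :+ (q :- r) := p :- r) ≡.refl

  neg-close : ∀ p q {ε} → ℚ.∣ p ℚ.- q ∣ ℚ.< ε → ℚ.∣ (ℚ.- p) ℚ.- (ℚ.- q) ∣ ℚ.< ε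
  neg-close p q {ε} p< = ≡.subst (λ s → ℚ.∣ s ∣ ℚ.< ε) (eq p q) (swap-close p q p<)
    where
    open +-*-Solver
    eq : ∀ p q → q ℚ.- p ≡ (ℚ.- p) ℚ.- (ℚ.- q)
    eq = +-*-Solver.solve 2 (λ p q → q :- p := (:- p) :- (:- q)) ≡.refl

  *-below : ∀ p q {A δ} → 0ℚ ℚ.< A → ℚ.∣ p ∣ ℚ.≤ A → ℚ.∣ q ∣ ℚ.< δ →
            ℚ.∣ p ℚ.* q ∣ ℚ.< A ℚ.* δ
  *-below p q {A} {δ} 0<A p≤ q< = begin-strict
    ℚ.∣ p ℚ.* q ∣         ≡⟨ ℚ.∣p*q∣≡∣p∣*∣q∣ p q ⟩
    ℚ.∣ p ∣ ℚ.* ℚ.∣ q ∣   ≤⟨ ℚ.*-monoʳ-≤-nonNeg ℚ.∣ q ∣ {{ℚ.∣-∣-nonNeg q}} p≤ ⟩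
    A ℚ.* ℚ.∣ q ∣         <⟨ ℚ.*-monoʳ-<-pos A {{ℚ.positive 0<A}} q< ⟩
    A ℚ.* δ               ∎
    where open ℚ.≤-Reasoning

  *-close : ∀ {A B δ} p p′ q q′ → 0ℚ ℚ.< A → 0ℚ ℚ.< B →
            ℚ.∣ p ∣ ℚ.≤ A → ℚ.∣ q′ ∣ ℚ.≤ B →
            ℚ.∣ p ℚ.- p′ ∣ ℚ.< δ → ℚ.∣ q ℚ.- q′ ∣ ℚ.< δ →
            ℚ.∣ p ℚ.* q ℚ.- p′ ℚ.* q′ ∣ ℚ.< (A ℚ.+ B) ℚ.* δ
  *-close {A} {B} {δ} p p′ q q′ 0<A 0<B p≤ q≤ p< q< = begin-strict
    ℚ.∣ p ℚ.* q ℚ.- p′ ℚ.* q′ ∣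
      ≡⟨ ≡.cong ℚ.∣_∣ (eq p p′ q q′) ⟩
    ℚ.∣ p ℚ.* (q ℚ.- q′) ℚ.+ q′ ℚ.* (p ℚ.- p′) ∣
      ≤⟨ ℚ.∣p+q∣≤∣p∣+∣q∣ (p ℚ.* (q ℚ.- q′)) (q′ ℚ.* (p ℚ.- p′)) ⟩
    ℚ.∣ p ℚ.* (q ℚ.- q′) ∣ ℚ.+ ℚ.∣ q′ ℚ.* (p ℚ.- p′) ∣
      <⟨ ℚ.+-mono-< (*-below p (q ℚ.- q′) 0<A p≤ q<) (*-below q′ (p ℚ.- p′) 0<B q≤ p<) ⟩
    A ℚ.* δ ℚ.+ B ℚ.* δ
      ≡⟨ ℚ.*-distribʳ-+ δ A B ⟨
    (A ℚ.+ B) ℚ.* δ ∎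
    where
    open ℚ.≤-Reasoning
    open +-*-Solver using (_:+_; _:*_; _:-_; _:=_)
    eq : ∀ p p′ q q′ →
         p ℚ.* q ℚ.- p′ ℚ.* q′ ≡ p ℚ.* (q ℚ.- q′) ℚ.+ q′ ℚ.* (p ℚ.- p′)
    eq = +-*-Solver.solve 4
      (λ p p′ q q′ → p :* q :- p′ :* q′ := p :* (q :- q′) :+ q′ :* (p :- p′)) ≡.refl

  shrink : ∀ {A ε} → 0ℚ ℚ.< A → 0ℚ ℚ.< ε → ∃[ δ ] 0ℚ ℚ.< δ × A ℚ.* δ ≡ ε
  shrink {A} {ε} 0<A 0<ε = A⁻¹ ℚ.* ε , δ-pos , A*δ≡ε
    where
    instance
      A-pos = ℚ.positive 0<A
      A-nonZero = ℚ.pos⇒nonZero A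
    A⁻¹ = ℚ.1/ A
    δ-pos : 0ℚ ℚ.< A⁻¹ ℚ.* ε
    δ-pos = ≡.subst (ℚ._< A⁻¹ ℚ.* ε) (ℚ.*-zeroʳ A⁻¹)
      (ℚ.*-monoʳ-<-pos A⁻¹ {{ℚ.1/pos⇒pos A}} 0<ε)
    A*δ≡ε : A ℚ.* (A⁻¹ ℚ.* ε) ≡ ε
    A*δ≡ε = ≡.trans (≡.sym (ℚ.*-assoc A A⁻¹ ε))
      (≡.trans (≡.cong (ℚ._* ε) (ℚ.*-inverseʳ A)) (ℚ.*-identityˡ ε))

-- Without η, conversion checking never compares the Cauchy proofs.
record ℝ : Set where
  no-eta-equality
  field
    seq    : ℕ → ℚ
    cauchy : ∀ ε → 0ℚ ℚ.< ε →
             ∃[ N ] (∀ m n → N ℕ.≤ m → N ℕ.≤ n → ℚ.∣ seq m ℚ.- seq n ∣ ℚ.< ε)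

open ℝ

infix 4 _≈ʳ_
record _≈ʳ_ (x y : ℝ) : Set where
  constructor mk≈
  field
    converge : ∀ ε → 0ℚ ℚ.< ε →
               ∃[ N ] (∀ n → N ℕ.≤ n → ℚ.∣ seq x n ℚ.- seq y n ∣ ℚ.< ε)

open _≈ʳ_

private
  ⊔ˡ : ∀ {M N n} → M ℕ.⊔ N ℕ.≤ n → M ℕ.≤ n
  ⊔ˡ {M} {N} = ℕ.m⊔n≤o⇒m≤o M N

  ⊔ʳ : ∀ {M N n} → M ℕ.⊔ N ℕ.≤ n → N ℕ.≤ n
  ⊔ʳ {M} {N} = ℕ.m⊔n≤o⇒n≤o M N

  bounded : ∀ x → ∃[ A ] 0ℚ ℚ.< A × ∃[ N ] (∀ n → N ℕ.≤ n → ℚ.∣ seq x n ∣ ℚ.≤ A)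
  bounded x with cauchy x 1ℚ (ℚ.positive⁻¹ 1ℚ)
  ... | N , close = ℚ.∣ seq x N ∣ ℚ.+ 1ℚ , A-pos , N , below
    where
    open ℚ.≤-Reasoning
    A-pos : 0ℚ ℚ.< ℚ.∣ seq x N ∣ ℚ.+ 1ℚ
    A-pos = ℚ.+-mono-≤-< (ℚ.0≤∣p∣ (seq x N)) (ℚ.positive⁻¹ 1ℚ)
    eq : ∀ p q → p ≡ q ℚ.+ (p ℚ.- q)
    eq = +-*-Solver.solve 2 (λ p q → p := q :+ (p :- q)) ≡.refl
      where open +-*-Solver
    below : ∀ n → N ℕ.≤ n → ℚ.∣ seq x n ∣ ℚ.≤ ℚ.∣ seq x N ∣ ℚ.+ 1ℚ
    below n N≤n = begin
      ℚ.∣ seq x n ∣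
        ≡⟨ ≡.cong ℚ.∣_∣ (eq (seq x n) (seq x N)) ⟩
      ℚ.∣ seq x N ℚ.+ (seq x n ℚ.- seq x N) ∣
        ≤⟨ ℚ.∣p+q∣≤∣p∣+∣q∣ (seq x N) (seq x n ℚ.- seq x N) ⟩
      ℚ.∣ seq x N ∣ ℚ.+ ℚ.∣ seq x n ℚ.- seq x N ∣
        ≤⟨ ℚ.+-monoʳ-≤ ℚ.∣ seq x N ∣ (ℚ.<⇒≤ (close n N N≤n ℕ.≤-refl)) ⟩
      ℚ.∣ seq x N ∣ ℚ.+ 1ℚ ∎

constʳ : ℚ → ℝ
constʳ p .seq _ = p
constʳ p .cauchy ε 0<ε = 0 , λ _ _ _ _ → self-close p 0<ε

infixl 6 _+ʳ_
infixl 7 _*ʳ_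
infix 8 -ʳ_

_+ʳ_ : ℝ → ℝ → ℝ
(x +ʳ y) .seq n = seq x n ℚ.+ seq y n
(x +ʳ y) .cauchy ε 0<ε =
  let M , x-close = cauchy x (½ ℚ.* ε) (½-pos 0<ε)
      N , y-close = cauchy y (½ ℚ.* ε) (½-pos 0<ε)
  in M ℕ.⊔ N , λ m n ≤m ≤n →
     +-close (seq x m) (seq x n) (seq y m) (seq y n)
       (x-close m n (⊔ˡ ≤m) (⊔ˡ ≤n)) (y-close m n (⊔ʳ {M} ≤m) (⊔ʳ {M} ≤n))

-ʳ_ : ℝ → ℝ
(-ʳ x) .seq n = ℚ.- seq x n
(-ʳ x) .cauchy ε 0<ε =
  let N , close = cauchy x ε 0<ε
  in N , λ m n ≤m ≤n → neg-close (seq x m) (seq x n) (close m n ≤m ≤n)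

_*ʳ_ : ℝ → ℝ → ℝ
(x *ʳ y) .seq n = seq x n ℚ.* seq y n
(x *ʳ y) .cauchy ε 0<ε =
  let A , 0<A , M₁ , x≤ = bounded x
      B , 0<B , M₂ , y≤ = bounded y
      δ , 0<δ , eq = shrink (ℚ.+-mono-< 0<A 0<B) 0<ε
      N₁ , x-close = cauchy x δ 0<δ
      N₂ , y-close = cauchy y δ 0<δ
  in (M₁ ℕ.⊔ M₂) ℕ.⊔ (N₁ ℕ.⊔ N₂) , λ m n ≤m ≤n →
     ≡.subst (ℚ.∣ seq x m ℚ.* seq y m ℚ.- seq x n ℚ.* seq y n ∣ ℚ.<_) eq
       (*-close (seq x m) (seq x n) (seq y m) (seq y n) 0<A 0<B
         (x≤ m (⊔ˡ (⊔ˡ ≤m))) (y≤ n (⊔ʳ {M₁} (⊔ˡ ≤n)))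
         (x-close m n (⊔ˡ (⊔ʳ {M₁ ℕ.⊔ M₂} ≤m)) (⊔ˡ (⊔ʳ {M₁ ℕ.⊔ M₂} ≤n)))
         (y-close m n (⊔ʳ {N₁} (⊔ʳ {M₁ ℕ.⊔ M₂} ≤m)) (⊔ʳ {N₁} (⊔ʳ {M₁ ℕ.⊔ M₂} ≤n))))

private
  pointwise : ∀ {x y} → (∀ n → seq x n ≡ seq y n) → x ≈ʳ y
  pointwise {x} {y} eq = mk≈ λ ε 0<ε → 0 , λ n _ →
    ≡.subst (λ p → ℚ.∣ seq x n ℚ.- p ∣ ℚ.< ε) (eq n) (self-close (seq x n) 0<ε)

  ≈ʳ-sym : ∀ {x y} → x ≈ʳ y → y ≈ʳ x
  ≈ʳ-sym {x} {y} x≈y = mk≈ λ ε 0<ε →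
    let N , close = converge x≈y ε 0<ε
    in N , λ n ≤n → swap-close (seq x n) (seq y n) (close n ≤n)

  ≈ʳ-trans : ∀ {x y z} → x ≈ʳ y → y ≈ʳ z → x ≈ʳ z
  ≈ʳ-trans {x} {y} {z} x≈y y≈z = mk≈ λ ε 0<ε →
    let M , xy-close = converge x≈y (½ ℚ.* ε) (½-pos 0<ε)
        N , yz-close = converge y≈z (½ ℚ.* ε) (½-pos 0<ε)
    in M ℕ.⊔ N , λ n ≤n → trans-close (seq x n) (seq y n) (seq z n)
         (xy-close n (⊔ˡ ≤n)) (yz-close n (⊔ʳ {M} ≤n))

  +ʳ-cong : ∀ {x x′ y y′} → x ≈ʳ x′ → y ≈ʳ y′ → x +ʳ y ≈ʳ x′ +ʳ y′
  +ʳ-cong {x} {x′} {y} {y′} x≈ y≈ = mk≈ λ ε 0<ε →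
    let M , x-close = converge x≈ (½ ℚ.* ε) (½-pos 0<ε)
        N , y-close = converge y≈ (½ ℚ.* ε) (½-pos 0<ε)
    in M ℕ.⊔ N , λ n ≤n → +-close (seq x n) (seq x′ n) (seq y n) (seq y′ n)
         (x-close n (⊔ˡ ≤n)) (y-close n (⊔ʳ {M} ≤n))

  -ʳ-cong : ∀ {x y} → x ≈ʳ y → -ʳ x ≈ʳ -ʳ y
  -ʳ-cong {x} {y} x≈y = mk≈ λ ε 0<ε →
    let N , close = converge x≈y ε 0<ε
    in N , λ n ≤n → neg-close (seq x n) (seq y n) (close n ≤n)

  *ʳ-cong : ∀ {x x′ y y′} → x ≈ʳ x′ → y ≈ʳ y′ → x *ʳ y ≈ʳ x′ *ʳ y′
  *ʳ-cong {x} {x′} {y} {y′} x≈ y≈ = mk≈ λ ε 0<ε →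
    let A , 0<A , M₁ , x≤ = bounded x
        B , 0<B , M₂ , y≤ = bounded y′
        δ , 0<δ , eq = shrink (ℚ.+-mono-< 0<A 0<B) 0<ε
        N₁ , x-close = converge x≈ δ 0<δ
        N₂ , y-close = converge y≈ δ 0<δ
    in (M₁ ℕ.⊔ M₂) ℕ.⊔ (N₁ ℕ.⊔ N₂) , λ n ≤n →
       ≡.subst (ℚ.∣ seq x n ℚ.* seq y n ℚ.- seq x′ n ℚ.* seq y′ n ∣ ℚ.<_) eq
         (*-close (seq x n) (seq x′ n) (seq y n) (seq y′ n) 0<A 0<B
           (x≤ n (⊔ˡ (⊔ˡ ≤n))) (y≤ n (⊔ʳ {M₁} (⊔ˡ ≤n)))
           (x-close n (⊔ˡ (⊔ʳ {M₁ ℕ.⊔ M₂} ≤n)))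
           (y-close n (⊔ʳ {N₁} (⊔ʳ {M₁ ℕ.⊔ M₂} ≤n))))

ℝ-ring : CommutativeRing 0ℓ 0ℓ
ℝ-ring = record
  { Carrier = ℝ
  ; _≈_ = _≈ʳ_
  ; _+_ = _+ʳ_
  ; _*_ = _*ʳ_
  ; -_ = -ʳ_
  ; 0# = constʳ 0ℚ
  ; 1# = constʳ 1ℚ
  ; isCommutativeRing = record
    { isRing = record
      { +-isAbelianGroup = record
        { isGroup = record
          { isMonoid = record
            { isSemigroup = record
              { isMagma = record
                { isEquivalence = record
                  { refl = pointwise λ _ → ≡.refl
                  ; sym = ≈ʳ-sym
                  ; trans = ≈ʳ-trans
                  }
                ; ∙-cong = +ʳ-cong
                }
              ; assoc = λ x y z → pointwise λ n → ℚ.+-assoc (seq x n) (seq y n) (seq z n)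
              }
            ; identity = (λ x → pointwise λ n → ℚ.+-identityˡ (seq x n))
                       , (λ x → pointwise λ n → ℚ.+-identityʳ (seq x n))
            }
          ; inverse = (λ x → pointwise λ n → ℚ.+-inverseˡ (seq x n))
                    , (λ x → pointwise λ n → ℚ.+-inverseʳ (seq x n))
          ; ⁻¹-cong = -ʳ-cong
          }
        ; comm = λ x y → pointwise λ n → ℚ.+-comm (seq x n) (seq y n)
        }
      ; *-cong = *ʳ-cong
      ; *-assoc = λ x y z → pointwise λ n → ℚ.*-assoc (seq x n) (seq y n) (seq z n)
      ; *-identity = (λ x → pointwise λ n → ℚ.*-identityˡ (seq x n))
                   , (λ x → pointwise λ n → ℚ.*-identityʳ (seq x n))
      ; distrib =
          (λ x y z → pointwise λ n → ℚ.*-distribˡ-+ (seq x n) (seq y n) (seq z n))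
        , (λ x y z → pointwise λ n → ℚ.*-distribʳ-+ (seq x n) (seq y n) (seq z n))
      }
    ; *-comm = λ x y → pointwise λ n → ℚ.*-comm (seq x n) (seq y n)
    }
  }

record ℂ : Set where
  constructor _+i_
  field
    re im : ℝ

open ℂ

infix 4 _≈ᶜ_
record _≈ᶜ_ (z w : ℂ) : Set where
  constructor _,_
  field
    re-≈ : re z ≈ʳ re w
    im-≈ : im z ≈ʳ im w

infixl 6 _+ᶜ_
infixl 7 _*ᶜ_
infix 8 -ᶜ_

_+ᶜ_ _*ᶜ_ : ℂ → ℂ → ℂ
z +ᶜ w = (re z +ʳ re w) +i (im z +ʳ im w)
z *ᶜ w = (re z *ʳ re w +ʳ -ʳ (im z *ʳ im w)) +i (re z *ʳ im w +ʳ im z *ʳ re w)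

-ᶜ_ conj : ℂ → ℂ
-ᶜ z = (-ʳ re z) +i (-ʳ im z)
conj z = re z +i (-ʳ im z)

fromℝ : ℝ → ℂ
fromℝ x = x +i constʳ 0ℚ

0ᶜ 1ᶜ : ℂ
0ᶜ = fromℝ (constʳ 0ℚ)
1ᶜ = fromℝ (constʳ 1ℚ)

∣_∣² : ℂ → ℝ
∣ z ∣² = re z *ʳ re z +ʳ im z *ʳ im z

private
  module ℝR = CommutativeRing ℝ-ring

  *ᶜ-cong : ∀ {z z′ w w′} → z ≈ᶜ z′ → w ≈ᶜ w′ → z *ᶜ w ≈ᶜ z′ *ᶜ w′
  *ᶜ-cong (p , q) (p′ , q′) =
      +ʳ-cong (*ʳ-cong p p′) (-ʳ-cong (*ʳ-cong q q′))
    , +ʳ-cong (*ʳ-cong p q′) (*ʳ-cong q p′)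

  *ᶜ-assoc : ∀ z w v → (z *ᶜ w) *ᶜ v ≈ᶜ z *ᶜ (w *ᶜ v)
  *ᶜ-assoc (a +i b) (x +i y) (p +i q) =
      pointwise (λ n → re-eq (seq a n) (seq b n) (seq x n) (seq y n) (seq p n) (seq q n))
    , pointwise (λ n → im-eq (seq a n) (seq b n) (seq x n) (seq y n) (seq p n) (seq q n))
    where
    open +-*-Solver
    re-eq : ∀ a b x y p q →
      (a ℚ.* x ℚ.+ ℚ.- (b ℚ.* y)) ℚ.* p ℚ.+ ℚ.- ((a ℚ.* y ℚ.+ b ℚ.* x) ℚ.* q) ≡
      a ℚ.* (x ℚ.* p ℚ.+ ℚ.- (y ℚ.* q)) ℚ.+ ℚ.- (b ℚ.* (x ℚ.* q ℚ.+ y ℚ.* p))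
    re-eq = +-*-Solver.solve 6 (λ a b x y p q →
      (a :* x :+ :- (b :* y)) :* p :+ :- ((a :* y :+ b :* x) :* q) :=
      a :* (x :* p :+ :- (y :* q)) :+ :- (b :* (x :* q :+ y :* p))) ≡.refl
    im-eq : ∀ a b x y p q →
      (a ℚ.* x ℚ.+ ℚ.- (b ℚ.* y)) ℚ.* q ℚ.+ (a ℚ.* y ℚ.+ b ℚ.* x) ℚ.* p ≡
      a ℚ.* (x ℚ.* q ℚ.+ y ℚ.* p) ℚ.+ b ℚ.* (x ℚ.* p ℚ.+ ℚ.- (y ℚ.* q))
    im-eq = +-*-Solver.solve 6 (λ a b x y p q →
      (a :* x :+ :- (b :* y)) :* q :+ (a :* y :+ b :* x) :* p :=
      a :* (x :* q :+ y :* p) :+ b :* (x :* p :+ :- (y :* q))) ≡.refl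

  *ᶜ-comm : ∀ z w → z *ᶜ w ≈ᶜ w *ᶜ z
  *ᶜ-comm (a +i b) (x +i y) =
      pointwise (λ n → re-eq (seq a n) (seq b n) (seq x n) (seq y n))
    , pointwise (λ n → im-eq (seq a n) (seq b n) (seq x n) (seq y n))
    where
    open +-*-Solver
    re-eq : ∀ a b x y →
      a ℚ.* x ℚ.+ ℚ.- (b ℚ.* y) ≡ x ℚ.* a ℚ.+ ℚ.- (y ℚ.* b)
    re-eq = +-*-Solver.solve 4 (λ a b x y →
      a :* x :+ :- (b :* y) := x :* a :+ :- (y :* b)) ≡.refl
    im-eq : ∀ a b x y →
      a ℚ.* y ℚ.+ b ℚ.* x ≡ x ℚ.* b ℚ.+ y ℚ.* a
    im-eq = +-*-Solver.solve 4 (λ a b x y →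
      a :* y :+ b :* x := x :* b :+ y :* a) ≡.refl

  *ᶜ-identityˡ : ∀ z → 1ᶜ *ᶜ z ≈ᶜ z
  *ᶜ-identityˡ (x +i y) =
      pointwise (λ n → re-eq (seq x n) (seq y n))
    , pointwise (λ n → im-eq (seq x n) (seq y n))
    where
    open +-*-Solver
    re-eq : ∀ x y →
      1ℚ ℚ.* x ℚ.+ ℚ.- (0ℚ ℚ.* y) ≡ x
    re-eq = +-*-Solver.solve 2 (λ x y →
      con 1ℚ :* x :+ :- (con 0ℚ :* y) := x) ≡.refl
    im-eq : ∀ x y →
      1ℚ ℚ.* y ℚ.+ 0ℚ ℚ.* x ≡ y
    im-eq = +-*-Solver.solve 2 (λ x y →
      con 1ℚ :* y :+ con 0ℚ :* x := y) ≡.refl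

  *ᶜ-distribˡ-+ᶜ : ∀ z w v → z *ᶜ (w +ᶜ v) ≈ᶜ z *ᶜ w +ᶜ z *ᶜ v
  *ᶜ-distribˡ-+ᶜ (a +i b) (x +i y) (p +i q) =
      pointwise (λ n → re-eq (seq a n) (seq b n) (seq x n) (seq y n) (seq p n) (seq q n))
    , pointwise (λ n → im-eq (seq a n) (seq b n) (seq x n) (seq y n) (seq p n) (seq q n))
    where
    open +-*-Solver
    re-eq : ∀ a b x y p q →
      a ℚ.* (x ℚ.+ p) ℚ.+ ℚ.- (b ℚ.* (y ℚ.+ q)) ≡
      (a ℚ.* x ℚ.+ ℚ.- (b ℚ.* y)) ℚ.+ (a ℚ.* p ℚ.+ ℚ.- (b ℚ.* q))
    re-eq = +-*-Solver.solve 6 (λ a b x y p q →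
      a :* (x :+ p) :+ :- (b :* (y :+ q)) :=
      (a :* x :+ :- (b :* y)) :+ (a :* p :+ :- (b :* q))) ≡.refl
    im-eq : ∀ a b x y p q →
      a ℚ.* (y ℚ.+ q) ℚ.+ b ℚ.* (x ℚ.+ p) ≡
      (a ℚ.* y ℚ.+ b ℚ.* x) ℚ.+ (a ℚ.* q ℚ.+ b ℚ.* p)
    im-eq = +-*-Solver.solve 6 (λ a b x y p q →
      a :* (y :+ q) :+ b :* (x :+ p) :=
      (a :* y :+ b :* x) :+ (a :* q :+ b :* p)) ≡.refl

  ᶜ-isEquivalence : IsEquivalence _≈ᶜ_
  ᶜ-isEquivalence = record
    { refl = ℝR.refl , ℝR.refl
    ; sym = λ (p , q) → ℝR.sym p , ℝR.sym q
    ; trans = λ (p , q) (p′ , q′) → ℝR.trans p p′ , ℝR.trans q q′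
    }

  +ᶜ-cong : ∀ {z z′ w w′} → z ≈ᶜ z′ → w ≈ᶜ w′ → z +ᶜ w ≈ᶜ z′ +ᶜ w′
  +ᶜ-cong (p , q) (p′ , q′) = ℝR.+-cong p p′ , ℝR.+-cong q q′

  ᶜ-setoid : Setoid 0ℓ 0ℓ
  ᶜ-setoid = record { isEquivalence = ᶜ-isEquivalence }

ℂ-ring : CommutativeRing 0ℓ 0ℓ
ℂ-ring = record
  { Carrier = ℂ
  ; _≈_ = _≈ᶜ_
  ; _+_ = _+ᶜ_
  ; _*_ = _*ᶜ_
  ; -_ = -ᶜ_
  ; 0# = 0ᶜ
  ; 1# = 1ᶜ
  ; isCommutativeRing = record
    { isRing = record
      { +-isAbelianGroup = record
        { isGroup = record
          { isMonoid = record
            { isSemigroup = record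
              { isMagma = record { isEquivalence = ᶜ-isEquivalence ; ∙-cong = +ᶜ-cong }
              ; assoc = λ z w v →
                  ℝR.+-assoc (re z) (re w) (re v) , ℝR.+-assoc (im z) (im w) (im v)
              }
            ; identity = (λ z → ℝR.+-identityˡ (re z) , ℝR.+-identityˡ (im z))
                       , (λ z → ℝR.+-identityʳ (re z) , ℝR.+-identityʳ (im z))
            }
          ; inverse = (λ z → ℝR.-‿inverseˡ (re z) , ℝR.-‿inverseˡ (im z))
                    , (λ z → ℝR.-‿inverseʳ (re z) , ℝR.-‿inverseʳ (im z))
          ; ⁻¹-cong = λ (p , q) → ℝR.-‿cong p , ℝR.-‿cong q
          }
        ; comm = λ z w → ℝR.+-comm (re z) (re w) , ℝR.+-comm (im z) (im w)
        }
      ; *-cong = *ᶜ-cong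
      ; *-assoc = *ᶜ-assoc
      ; *-identity = comm∧idˡ⇒id *ᶜ-comm *ᶜ-identityˡ
      ; distrib = comm∧distrˡ⇒distr +ᶜ-cong *ᶜ-comm *ᶜ-distribˡ-+ᶜ
      }
    ; *-comm = *ᶜ-comm
    }
  }
  where open import Algebra.Consequences.Setoid ᶜ-setoid

conj-cong : ∀ {z w} → z ≈ᶜ w → conj z ≈ᶜ conj w
conj-cong (p , q) = p , ℝR.-‿cong q

conj-1 : conj 1ᶜ ≈ᶜ 1ᶜ
conj-1 = ℝR.refl , pointwise λ _ → ≡.refl

conj-* : ∀ z w → conj (z *ᶜ w) ≈ᶜ conj z *ᶜ conj w
conj-* (a +i b) (x +i y) =
    pointwise (λ n → re-eq (seq a n) (seq b n) (seq x n) (seq y n))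
  , pointwise (λ n → im-eq (seq a n) (seq b n) (seq x n) (seq y n))
  where
  open +-*-Solver
  re-eq : ∀ a b x y →
    a ℚ.* x ℚ.+ ℚ.- (b ℚ.* y) ≡ a ℚ.* x ℚ.+ ℚ.- ((ℚ.- b) ℚ.* (ℚ.- y))
  re-eq = +-*-Solver.solve 4 (λ a b x y →
    a :* x :+ :- (b :* y) := a :* x :+ :- ((:- b) :* (:- y))) ≡.refl
  im-eq : ∀ a b x y →
    ℚ.- (a ℚ.* y ℚ.+ b ℚ.* x) ≡ a ℚ.* (ℚ.- y) ℚ.+ (ℚ.- b) ℚ.* x
  im-eq = +-*-Solver.solve 4 (λ a b x y →
    :- (a :* y :+ b :* x) := a :* (:- y) :+ (:- b) :* x) ≡.refl

-- The unit group of a commutative ring; a unit carries its inverse, and units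
-- are compared as ring elements.
module _ (R : CommutativeRing c ℓ) where
  open CommutativeRing R
  open CommutativeSemigroupProperties *-commutativeSemigroup using (interchange)

  unitGroup : AbelianGroup (c ⊔ ℓ) ℓ
  unitGroup = record
    { Carrier = Σ Carrier (Invertible _≈_ 1# _*_)
    ; _≈_ = λ u v → proj₁ u ≈ proj₁ v
    ; _∙_ = λ (u , u⁻¹ , l , r) (v , v⁻¹ , l′ , r′) →
        u * v , u⁻¹ * v⁻¹ ,
        trans (interchange u⁻¹ v⁻¹ u v) (trans (*-cong l l′) (*-identityˡ 1#)) ,
        trans (interchange u v u⁻¹ v⁻¹) (trans (*-cong r r′) (*-identityˡ 1#))
    ; ε = 1# , 1# , *-identityˡ 1# , *-identityˡ 1#
    ; _⁻¹ = λ (u , u⁻¹ , l , r) → u⁻¹ , u , r , l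
    ; isAbelianGroup = record
      { isGroup = record
        { isMonoid = record
          { isSemigroup = record
            { isMagma = record
              { isEquivalence = record { refl = refl ; sym = sym ; trans = trans }
              ; ∙-cong = *-cong
              }
            ; assoc = λ u v w → *-assoc (proj₁ u) (proj₁ v) (proj₁ w)
            }
          ; identity = (λ u → *-identityˡ (proj₁ u)) , (λ u → *-identityʳ (proj₁ u))
          }
        ; inverse = (λ (_ , _ , l , _) → l) , (λ (_ , _ , _ , r) → r)
        ; ⁻¹-cong = λ {u} {v} → inverse-cong u v
        }
      ; comm = λ u v → *-comm (proj₁ u) (proj₁ v)
      }
    }
    where
    inverse-cong : (u v : Σ Carrier (Invertible _≈_ 1# _*_)) →
                   proj₁ u ≈ proj₁ v → proj₁ (proj₂ u) ≈ proj₁ (proj₂ v)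
    inverse-cong (u , u⁻¹ , l , _) (v , v⁻¹ , _ , r′) u≈v = begin
      u⁻¹              ≈⟨ *-identityʳ u⁻¹ ⟨
      u⁻¹ * 1#         ≈⟨ *-congˡ r′ ⟨
      u⁻¹ * (v * v⁻¹)  ≈⟨ *-congˡ (*-congʳ u≈v) ⟨
      u⁻¹ * (u * v⁻¹)  ≈⟨ *-assoc u⁻¹ u v⁻¹ ⟨
      u⁻¹ * u * v⁻¹    ≈⟨ *-congʳ l ⟩
      1# * v⁻¹         ≈⟨ *-identityˡ v⁻¹ ⟩
      v⁻¹              ∎
      where open import Relation.Binary.Reasoning.Setoid setoid

  -1ᵘ : AbelianGroup.Carrier unitGroup
  -1ᵘ = - 1# , - 1# , -1*-1≈1 , -1*-1≈1
    where
    open RingProperties ring using (-1*x≈-x; -‿involutive)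
    -1*-1≈1 : - 1# * - 1# ≈ 1#
    -1*-1≈1 = trans (-1*x≈-x (- 1#)) (-‿involutive 1#)

ℂˣ : AbelianGroup 0ℓ 0ℓ
ℂˣ = unitGroup ℂ-ring

conjˣ : AbelianGroup.Carrier ℂˣ → AbelianGroup.Carrier ℂˣ
conjˣ (z , w , l , r) = conj z , conj w , conj-inv l , conj-inv r
  where
  conj-inv : ∀ {z w} → z *ᶜ w ≈ᶜ 1ᶜ → conj z *ᶜ conj w ≈ᶜ 1ᶜ
  conj-inv {z} {w} p = ≈.trans (≈.sym (conj-* z w)) (≈.trans (conj-cong p) conj-1)
    where module ≈ = CommutativeRing ℂ-ring

conjˣ-homo : IsGroupHomomorphism (AbelianGroup.rawGroup ℂˣ) (AbelianGroup.rawGroup ℂˣ) conjˣ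
conjˣ-homo = record
  { isMonoidHomomorphism = record
    { isMagmaHomomorphism = record
      { isRelHomomorphism = record { cong = conj-cong }
      ; homo = λ (z , _) (w , _) → conj-* z w
      }
    ; ε-homo = conj-1
    }
  ; ⁻¹-homo = λ _ → CommutativeRing.refl ℂ-ring
  }

Character : RawGroup c ℓ → Set (c ⊔ ℓ)
Character G = GroupHomomorphism G (AbelianGroup.rawGroup ℂˣ)

module _ {G : RawGroup c ℓ} where
  open GroupHomomorphism
  private
    module G = RawGroup G
    module ℂˣ = AbelianGroup ℂˣ

  infix 9 _at_
  _at_ : Character G → G.Carrier → ℂ
  χ at x = proj₁ (⟦ χ ⟧ x)

  Trivial : Character G → Set c
  Trivial χ = ∀ x → χ at x ≈ᶜ 1ᶜ

  infixl 7 _·_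
  _·_ : Character G → Character G → Character G
  χ · η = record
    { ⟦_⟧ = λ x → ⟦ χ ⟧ x ℂˣ.∙ ⟦ η ⟧ x
    ; isGroupHomomorphism = record
      { isMonoidHomomorphism = record
        { isMagmaHomomorphism = record
          { isRelHomomorphism = record
            { cong = λ p → ≈.*-cong (⟦⟧-cong χ p) (⟦⟧-cong η p) }
          ; homo = λ x y → ≈.trans
              (≈.*-cong (homo χ x y) (homo η x y))
              (interchange (χ at x) (χ at y) (η at x) (η at y))
          }
        ; ε-homo = ≈.trans (≈.*-cong (ε-homo χ) (ε-homo η)) (≈.*-identityˡ 1ᶜ)
        }
      ; ⁻¹-homo = λ x → ≈.*-cong (⁻¹-homo χ x) (⁻¹-homo η x)
      }
    }
    where
    module ≈ = CommutativeRing ℂ-ring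
    open CommutativeSemigroupProperties ≈.*-commutativeSemigroup using (interchange)

  conjugate : Character G → Character G
  conjugate χ = record
    { ⟦_⟧ = λ x → conjˣ (⟦ χ ⟧ x)
    ; isGroupHomomorphism = Composition.isGroupHomomorphism
        (λ {x} {y} {z} → ℂˣ.trans {x} {y} {z})
        (isGroupHomomorphism χ) conjˣ-homo
    }

-- Ideals are arbitrary, not necessarily decidable, subsets.
record Ideal (R : CommutativeRing c ℓ) : Set (suc (c ⊔ ℓ)) where
  open CommutativeRing R
  field
    member   : Pred Carrier (c ⊔ ℓ)
    respects : ∀ {x y} → x ≈ y → x ∈ member → y ∈ member
    0∈       : 0# ∈ member
    +∈       : ∀ {x y} → x ∈ member → y ∈ member → x + y ∈ member
    *∈       : ∀ a {x} → x ∈ member → a * x ∈ member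

open Ideal

module _ (R : CommutativeRing c ℓ) where
  open CommutativeRing R

  IsFinite : Set (c ⊔ ℓ)
  IsFinite = ∃[ n ] Inverse setoid (≡.setoid (Fin n))

  zeroIdeal : Ideal R
  zeroIdeal = record
    { member   = λ x → Lift c (x ≈ 0#)
    ; respects = λ x≈y (lift x≈0) → lift (trans (sym x≈y) x≈0)
    ; 0∈       = lift refl
    ; +∈       = λ (lift x≈0) (lift y≈0) → lift (trans (+-cong x≈0 y≈0) (+-identityˡ 0#))
    ; *∈       = λ a (lift x≈0) → lift (trans (*-congˡ x≈0) (zeroʳ a))
    }

  IsWhole : Ideal R → Set (c ⊔ ℓ)
  IsWhole I = ∀ x → x ∈ member I

  IsMaximal : Ideal R → Set (suc (c ⊔ ℓ))
  IsMaximal I = ¬ IsWhole I ×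
    (∀ (J : Ideal R) → member I ⊆ member J → ¬ IsWhole J → member J ⊆ member I)

  record IsLocal : Set (suc (c ⊔ ℓ)) where
    field
      maximalIdeal : Ideal R
      isMaximal    : IsMaximal maximalIdeal
      unique       : ∀ (I : Ideal R) → IsMaximal I → member I ≐ member maximalIdeal

  Unit : Set (c ⊔ ℓ)
  Unit = AbelianGroup.Carrier (unitGroup R)

  AdditiveCharacter : Set (c ⊔ ℓ)
  AdditiveCharacter = Character (AbelianGroup.rawGroup +-abelianGroup)

  IsPrimitiveAdditive : AdditiveCharacter → Set (suc (c ⊔ ℓ))
  IsPrimitiveAdditive ψ =
    ∀ (I : Ideal R) → (∀ {x} → x ∈ member I → ψ at x ≈ᶜ 1ᶜ) → member I ≐ member zeroIdeal

  IsFrobenius : Set (suc (c ⊔ ℓ))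
  IsFrobenius = ∃[ ψ ] IsPrimitiveAdditive ψ

  MultiplicativeCharacter : Set (c ⊔ ℓ)
  MultiplicativeCharacter = Character (AbelianGroup.rawGroup (unitGroup R))

  module _ (local : IsLocal) where
    open IsLocal local renaming (maximalIdeal to M)

    -- I ⊆ M and χ is identically 1 on 1 + I (which then consists of units).
    TrivialOn1+ : MultiplicativeCharacter → Ideal R → Set (c ⊔ ℓ)
    TrivialOn1+ χ I = member I ⊆ member M ×
      (∀ {x} → x ∈ member I → (u : Unit) → proj₁ u ≈ 1# + x → χ at u ≈ᶜ 1ᶜ)

    IsConductor : MultiplicativeCharacter → Ideal R → Set (suc (c ⊔ ℓ))
    IsConductor χ I =
      (Trivial χ → IsWhole I) ×
      (¬ Trivial χ →
        TrivialOn1+ χ I × (∀ J → TrivialOn1+ χ J → member J ⊆ member I))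

    IsPrimitiveMultiplicative : MultiplicativeCharacter → Set (suc (c ⊔ ℓ))
    IsPrimitiveMultiplicative χ = IsConductor χ zeroIdeal

module _ (R : CommutativeRing c ℓ) (finite : IsFinite R) where
  open CommutativeRing R
  open SemiringSum (CommutativeRing.semiring ℂ-ring) using (sum)

  private
    open Inverse (proj₂ finite) using (to; from; to-cong; from-cong; strictlyInverseʳ)

  infix 4 _≈?_
  _≈?_ : Decidable _≈_
  x ≈? y = map′
    (λ eq → trans (sym (strictlyInverseʳ x))
                  (trans (from-cong eq) (strictlyInverseʳ y)))
    to-cong (to x ≟ᶠ to y)

  invertible? : ∀ x → Dec (Invertible _≈_ 1# _*_ x)
  invertible? x = map′
    (λ (i , p) → from i , p , trans (*-comm x (from i)) p)
    (λ (y , p , _) → to y , trans (*-congʳ (strictlyInverseʳ y)) p)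
    (any? λ i → from i * x ≈? 1#)

  extendByZero : (Unit R → ℂ) → ∀ x → Dec (Invertible _≈_ 1# _*_ x) → ℂ
  extendByZero f x (yes inv) = f (x , inv)
  extendByZero f x (no _)    = 0ᶜ

  -- The sum over the unit group runs over the whole ring, skipping non-units.
  ∑ˣ : (Unit R → ℂ) → ℂ
  ∑ˣ f = sum λ i → extendByZero f (from i) (invertible? (from i))

  module _ (ψ : AdditiveCharacter R) where

    kloosterman : MultiplicativeCharacter R → Unit R → ℂ
    kloosterman τ (a , _) = ∑ˣ λ (u , u⁻¹ , inv) →
      τ at (u , u⁻¹ , inv) *ᶜ ψ at (u + a * u⁻¹)

    gauss : MultiplicativeCharacter R → ℂ
    gauss χ = ∑ˣ λ u → ψ at (proj₁ u) *ᶜ χ at u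

  jacobi : MultiplicativeCharacter R → MultiplicativeCharacter R → ℂ
  jacobi χ η = ∑ˣ λ u → ∑ˣ λ v →
    if does (proj₁ u + proj₁ v ≈? 1#) then χ at u *ᶜ η at v else 0ᶜ

{-# OPTIONS --safe #-}

-- Write S(w) = ∑ χ(b)ψ(bw). Expanding K_τ(a)K_η(a) as a double sum over units
-- u, v and replacing a by uva turns its argument into (u + v)(1 + a), so that
--   ∑ χ(a)K_τ(a)K_η(a) = ∑ χτ(u) χη(v) ψ(u + v) S(u + v).
-- For a unit w, S(w) = χ(w)⁻¹G(χ). For a non-unit w, S(w) = 0: otherwise
-- χ(t) = 1 whenever tw = w, so χ is trivial on 1 + Ann(w), although Ann(w) ≠ 0.
-- Grouping the pairs (u, v) by c = u + v and scaling them by c gives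
-- G(χτη)G(χ)J(χτ,χη). Take η to be the conjugate of τ: characters of finite
-- groups have modulus 1, so conj K_τ = τ(-1)K_η and χτη = χ.
module Submission where

open import Defs
open import Algebra.Bundles using (AbelianGroup; CommutativeRing)
open import Algebra.Bundles.Raw using (RawGroup)
open import Algebra.Definitions using (Invertible)
open import Algebra.Morphism.Bundles using (GroupHomomorphism)
import Algebra.Properties.AbelianGroup as AbelianGroupProperties
import Algebra.Properties.CommutativeSemigroup as CommutativeSemigroupProperties
import Algebra.Properties.Group as GroupProperties
import Algebra.Properties.Ring as RingProperties
import Algebra.Properties.Semiring.Sum as SemiringSum
import Algebra.Solver.CommutativeMonoid as CommutativeMonoidSolver
open import Data.Bool.Base using (true; false; if_then_else_)
open import Data.Fin.Base using (Fin; zero; suc; punchIn; punchOut)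
open import Data.Fin.Permutation using (permutation)
open import Data.Fin.Properties using (any?; injective⇒≤; punchInᵢ≢i; punchOut-injective)
  renaming (_≟_ to _≟ᶠ_)
open import Data.Nat.Base as ℕ using (ℕ)
import Data.Nat.Properties as ℕ
open import Data.Product.Base using (∃-syntax; _×_; _,_; proj₁; proj₂)
open import Data.Rational.Base as ℚ using (ℚ; 0ℚ; 1ℚ; ½)
import Data.Rational.Properties as ℚ
open import Data.Rational.Solver using (module +-*-Solver)
open import Data.Sum.Base using (_⊎_; inj₁; inj₂)
open import Function.Base using (_∘_)
open import Function.Bundles using (Inverse; mk⇔)
open import Function.Definitions using (Injective)
open import Level using (Lift; lift; lower)
open import Relation.Binary.PropositionalEquality as ≡ using (_≡_; _≢_)
import Relation.Binary.Reasoning.Setoid as SetoidReasoning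
open import Relation.Nullary using (¬_; Dec; yes; no; does; contradiction)
open import Relation.Nullary.Decidable using (does-⇔; dec-true; dec-false; map′)
open import Relation.Unary as Unary using (_∈_; _⊆_)

open ℝ
open _≈ʳ_
open ℂ
open GroupHomomorphism using (⟦_⟧; ⟦⟧-cong; homo; ε-homo; ⁻¹-homo)

-- Two facts replace it: being 0 is stable under double negation, and zw = 0 with z merely not 0
-- forces w = 0. The modulus of a character is found in the same spirit, without roots of unity:
-- shifting the variable by u gives |χ(u)|² Σ|χ|² = Σ|χ|², and the sum of squares can be cancelled
-- because it is not 0. On the side of the ring equality is decidable, but an ideal is an arbitrary
-- subset. Hence the maximal ideal above a non-unit has to be built by finitely many adjunctions to
-- a decidable ideal. That a non-unit has a nonzero annihilator comes from finiteness: an injective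
-- multiplication map is surjective. Sums over units are sums over the whole ring of functions
-- extended by 0, so every substitution in a unit variable is carried out as a permutation of the
-- ring.

private
  module ℝR = CommutativeRing ℝ-ring
  module ℂR = CommutativeRing ℂ-ring

open SemiringSum ℂR.semiring using
  ( sum; sum-cong-≋; sum-remove; sum-permute; sum-replicate-zero
  ; ∑-comm; *-distribˡ-sum; *-distribʳ-sum )

-- Real and complex numbers

0ʳ : ℝ
0ʳ = constʳ 0ℚ

pointwise : ∀ {x y} → (∀ n → seq x n ≡ seq y n) → x ≈ʳ y
pointwise {x} {y} eq = mk≈ λ ε 0<ε → 0 , λ n _ → ≡.subst (λ p → ℚ.∣ p ∣ ℚ.< ε)
  (≡.sym (≡.trans (≡.cong (λ p → seq x n ℚ.- p) (≡.sym (eq n))) (ℚ.+-inverseʳ (seq x n)))) 0<ε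

Eventually : (ℕ → Set) → Set
Eventually P = ∃[ N ] (∀ n → N ℕ.≤ n → P n)

-- A real is 0 exactly when it is eventually below every positive ε. Being eventually above some
-- positive ε is the constructive form of being nonzero.
EventuallyBelow EventuallyAbove : ℝ → ℚ → Set
EventuallyBelow x ε = Eventually λ n → ℚ.∣ seq x n ∣ ℚ.< ε
EventuallyAbove x ε = Eventually λ n → ε ℚ.< ℚ.∣ seq x n ∣

private
  minus-zero : ∀ p → p ℚ.- 0ℚ ≡ p
  minus-zero = +-*-Solver.solve 1 (λ p → p :- con 0ℚ := p) ≡.refl
    where open +-*-Solver

≈0⇒below : ∀ {x} → x ≈ʳ 0ʳ → ∀ ε → 0ℚ ℚ.< ε → EventuallyBelow x ε
≈0⇒below {x} x≈0 ε 0<ε =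
  let N , close = converge x≈0 ε 0<ε
  in N , λ n N≤n → ≡.subst (λ p → ℚ.∣ p ∣ ℚ.< ε) (minus-zero (seq x n)) (close n N≤n)

below⇒≈0 : ∀ {x} → (∀ ε → 0ℚ ℚ.< ε → EventuallyBelow x ε) → x ≈ʳ 0ʳ
below⇒≈0 {x} below = mk≈ λ ε 0<ε →
  let N , close = below ε 0<ε
  in N , λ n N≤n → ≡.subst (λ p → ℚ.∣ p ∣ ℚ.< ε) (≡.sym (minus-zero (seq x n))) (close n N≤n)

private
  halve : ∀ {ε} → 0ℚ ℚ.< ε → ∃[ δ ] 0ℚ ℚ.< δ × δ ℚ.+ δ ≡ ε
  halve {ε} 0<ε = ½ ℚ.* ε
    , ≡.subst (ℚ._< ½ ℚ.* ε) (ℚ.*-zeroʳ ½) (ℚ.*-monoʳ-<-pos ½ 0<ε)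
    , ≡.trans (≡.sym (ℚ.*-distribʳ-+ ε ½ ½)) (ℚ.*-identityˡ ε)

  triangle : ∀ p q → ℚ.∣ p ∣ ℚ.≤ ℚ.∣ q ∣ ℚ.+ ℚ.∣ p ℚ.- q ∣
  triangle p q = ≡.subst (λ r → ℚ.∣ r ∣ ℚ.≤ ℚ.∣ q ∣ ℚ.+ ℚ.∣ p ℚ.- q ∣) (eq p q)
    (ℚ.∣p+q∣≤∣p∣+∣q∣ q (p ℚ.- q))
    where
    open +-*-Solver
    eq : ∀ p q → q ℚ.+ (p ℚ.- q) ≡ p
    eq = +-*-Solver.solve 2 (λ p q → q :+ (p :- q) := p) ≡.refl

-- A Cauchy sequence is eventually either small or bounded away from 0, and a
-- single late term decides which.
not-above⇒≈0 : ∀ {x} → (∀ ε → 0ℚ ℚ.< ε → ¬ EventuallyAbove x ε) → x ≈ʳ 0ʳ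
not-above⇒≈0 {x} ¬above = below⇒≈0 λ ε 0<ε → below ε 0<ε
  where
  below : ∀ ε → 0ℚ ℚ.< ε → EventuallyBelow x ε
  -- The late term is compared with η = ε/2, and the Cauchy condition is used with δ = ε/4. A small
  -- late term leaves room below ε; a large one keeps all later terms above η - δ = δ.
  below ε 0<ε with halve 0<ε
  ... | η , 0<η , η+η≡ε with halve 0<η
  ... | δ , 0<δ , δ+δ≡η with cauchy x δ 0<δ
  ... | N , close with ℚ.∣ seq x N ∣ ℚ.<? η
  ... | yes small = N , λ n N≤n → begin-strict
    ℚ.∣ seq x n ∣                                  ≤⟨ triangle (seq x n) (seq x N) ⟩
    ℚ.∣ seq x N ∣ ℚ.+ ℚ.∣ seq x n ℚ.- seq x N ∣    <⟨ ℚ.+-mono-< small (close n N N≤n ℕ.≤-refl) ⟩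
    η ℚ.+ δ                                        ≡⟨ ≡.cong (η ℚ.+_) (ℚ.+-identityʳ δ) ⟨
    η ℚ.+ (δ ℚ.+ 0ℚ)                               <⟨ ℚ.+-monoʳ-< η (ℚ.+-monoʳ-< δ 0<δ) ⟩
    η ℚ.+ (δ ℚ.+ δ)                                ≡⟨ ≡.cong (η ℚ.+_) δ+δ≡η ⟩
    η ℚ.+ η                                        ≡⟨ η+η≡ε ⟩
    ε                                              ∎
    where open ℚ.≤-Reasoning
  ... | no large = contradiction (N , above) (¬above δ 0<δ)
    where
    above : ∀ n → N ℕ.≤ n → δ ℚ.< ℚ.∣ seq x n ∣
    above n N≤n = ℚ.≰⇒> λ small → ℚ.<-irrefl ≡.refl (begin-strict
      η                                              ≤⟨ ℚ.≮⇒≥ large ⟩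
      ℚ.∣ seq x N ∣                                  ≤⟨ triangle (seq x N) (seq x n) ⟩
      ℚ.∣ seq x n ∣ ℚ.+ ℚ.∣ seq x N ℚ.- seq x n ∣    <⟨ ℚ.+-mono-≤-< small (close N n ℕ.≤-refl N≤n) ⟩
      δ ℚ.+ δ                                        ≡⟨ δ+δ≡η ⟩
      η                                              ∎)
      where open ℚ.≤-Reasoning

-- Being bounded away from 0 is refuted at a single common index, and a refutation may use a doubly
-- negated hypothesis. This licenses proofs by contradiction of equations with right side 0.
≈0-stable : ∀ {x} → ¬ ¬ x ≈ʳ 0ʳ → x ≈ʳ 0ʳ
≈0-stable {x} ¬¬x≈0 = not-above⇒≈0 λ ε 0<ε (M , above) → ¬¬x≈0 λ x≈0 →
  let N , below = ≈0⇒below x≈0 ε 0<ε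
  in ℚ.<-asym (above (M ℕ.⊔ N) (ℕ.m≤m⊔n M N)) (below (M ℕ.⊔ N) (ℕ.m≤n⊔m M N))

-- The hypothesis on x is negative and yields no lower bound for |x|, so division by x is
-- impossible. If |y| stays above ε, then |xy| < εδ gives |x| < δ for every δ, which contradicts the
-- hypothesis; hence y is never bounded away from 0.
*ʳ-cancel-zero : ∀ {x y} → x *ʳ y ≈ʳ 0ʳ → ¬ x ≈ʳ 0ʳ → y ≈ʳ 0ʳ
*ʳ-cancel-zero {x} {y} xy≈0 x≉0 = not-above⇒≈0 λ ε 0<ε (M , above) →
  x≉0 (below⇒≈0 λ δ 0<δ → x-below ε 0<ε M above δ 0<δ)
  where
  x-below : ∀ ε → 0ℚ ℚ.< ε → ∀ M → (∀ n → M ℕ.≤ n → ε ℚ.< ℚ.∣ seq y n ∣) →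
            ∀ δ → 0ℚ ℚ.< δ → EventuallyBelow x δ
  x-below ε 0<ε M above δ 0<δ =
    let N , below = ≈0⇒below xy≈0 (ε ℚ.* δ) 0<εδ
    in M ℕ.⊔ N , λ n ≤n → ℚ.*-cancelˡ-<-nonNeg ε {{ℚ.pos⇒nonNeg ε}} (begin-strict
      ε ℚ.* ℚ.∣ seq x n ∣
        ≤⟨ ℚ.*-monoʳ-≤-nonNeg ℚ.∣ seq x n ∣ {{ℚ.∣-∣-nonNeg (seq x n)}}
             (ℚ.<⇒≤ (above n (ℕ.m⊔n≤o⇒m≤o M N ≤n))) ⟩
      ℚ.∣ seq y n ∣ ℚ.* ℚ.∣ seq x n ∣   ≡⟨ ℚ.*-comm ℚ.∣ seq y n ∣ ℚ.∣ seq x n ∣ ⟩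
      ℚ.∣ seq x n ∣ ℚ.* ℚ.∣ seq y n ∣   ≡⟨ ℚ.∣p*q∣≡∣p∣*∣q∣ (seq x n) (seq y n) ⟨
      ℚ.∣ seq x n ℚ.* seq y n ∣         <⟨ below n (ℕ.m⊔n≤o⇒n≤o M N ≤n) ⟩
      ε ℚ.* δ                           ∎)
    where
    open ℚ.≤-Reasoning
    instance
      ε-positive = ℚ.positive 0<ε
    0<εδ : 0ℚ ℚ.< ε ℚ.* δ
    0<εδ = ≡.subst (ℚ._< ε ℚ.* δ) (ℚ.*-zeroʳ ε) (ℚ.*-monoʳ-<-pos ε 0<δ)

x*x≈0⇒x≈0 : ∀ {x} → x *ʳ x ≈ʳ 0ʳ → x ≈ʳ 0ʳ
x*x≈0⇒x≈0 xx≈0 = ≈0-stable λ x≉0 → x≉0 (*ʳ-cancel-zero xx≈0 x≉0)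

-- A condition on the representing sequence, not invariant under `_≈ʳ_`. Sums of squares satisfy it
-- termwise, and it lets a sum dominate each of its summands term by term.
NonNegative : ℝ → Set
NonNegative x = ∀ n → 0ℚ ℚ.≤ seq x n

square-nonNegative : ∀ x → NonNegative (x *ʳ x)
square-nonNegative x n = ≡.subst (0ℚ ℚ.≤_) (square (ℚ.∣p∣≡p∨∣p∣≡-p (seq x n))) 
  (ℚ.0≤∣p∣ (seq x n ℚ.* seq x n))
  where
  open +-*-Solver
  p = seq x n
  square : ℚ.∣ p ∣ ≡ p ⊎ ℚ.∣ p ∣ ≡ ℚ.- p → ℚ.∣ p ℚ.* p ∣ ≡ p ℚ.* p
  square (inj₁ eq) = ≡.trans (ℚ.∣p*q∣≡∣p∣*∣q∣ p p) (≡.cong₂ ℚ._*_ eq eq)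
  square (inj₂ eq) = ≡.trans (ℚ.∣p*q∣≡∣p∣*∣q∣ p p) (≡.trans (≡.cong₂ ℚ._*_ eq eq)
    (+-*-Solver.solve 1 (λ p → (:- p) :* (:- p) := p :* p) ≡.refl p))

+-nonNegative : ∀ {x y} → NonNegative x → NonNegative y → NonNegative (x +ʳ y)
+-nonNegative 0≤x 0≤y n = ℚ.+-mono-≤ (0≤x n) (0≤y n)

x+y≈0⇒x≈0 : ∀ {x y} → NonNegative x → NonNegative y → x +ʳ y ≈ʳ 0ʳ → x ≈ʳ 0ʳ
x+y≈0⇒x≈0 {x} {y} 0≤x 0≤y x+y≈0 = below⇒≈0 λ ε 0<ε →
  let N , below = ≈0⇒below x+y≈0 ε 0<ε
  in N , λ n N≤n → ℚ.≤-<-trans (∣x∣≤ n) (below n N≤n)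
  where
  open ℚ.≤-Reasoning
  ∣x∣≤ : ∀ n → ℚ.∣ seq x n ∣ ℚ.≤ ℚ.∣ seq x n ℚ.+ seq y n ∣
  ∣x∣≤ n = begin
    ℚ.∣ seq x n ∣              ≡⟨ ℚ.0≤p⇒∣p∣≡p (0≤x n) ⟩
    seq x n                    ≡⟨ ℚ.+-identityʳ (seq x n) ⟨
    seq x n ℚ.+ 0ℚ             ≤⟨ ℚ.+-monoʳ-≤ (seq x n) (0≤y n) ⟩
    seq x n ℚ.+ seq y n        ≡⟨ ℚ.0≤p⇒∣p∣≡p (+-nonNegative {x} {y} 0≤x 0≤y n) ⟨
    ℚ.∣ seq x n ℚ.+ seq y n ∣  ∎

x+y≈0⇒y≈0 : ∀ {x y} → NonNegative x → NonNegative y → x +ʳ y ≈ʳ 0ʳ → y ≈ʳ 0ʳ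
x+y≈0⇒y≈0 {x} {y} 0≤x 0≤y x+y≈0 =
  x+y≈0⇒x≈0 0≤y 0≤x (ℝR.trans (ℝR.+-comm y x) x+y≈0)

∣∣²-cong : ∀ {z w} → z ≈ᶜ w → ∣ z ∣² ≈ʳ ∣ w ∣²
∣∣²-cong (p , q) = ℝR.+-cong (ℝR.*-cong p p) (ℝR.*-cong q q)

∣∣²-nonNegative : ∀ z → NonNegative ∣ z ∣²
∣∣²-nonNegative (x +i y) = +-nonNegative {x *ʳ x} {y *ʳ y} (square-nonNegative x) (square-nonNegative y)

∣0∣²≈0 : ∣ 0ᶜ ∣² ≈ʳ 0ʳ
∣0∣²≈0 = pointwise λ _ → ≡.refl

∣∣²≈0⇒≈0 : ∀ {z} → ∣ z ∣² ≈ʳ 0ʳ → z ≈ᶜ 0ᶜ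
∣∣²≈0⇒≈0 {x +i y} eq =
    x*x≈0⇒x≈0 (x+y≈0⇒x≈0 (square-nonNegative x) (square-nonNegative y) eq)
  , x*x≈0⇒x≈0 (x+y≈0⇒y≈0 (square-nonNegative x) (square-nonNegative y) eq)

∣∣²-* : ∀ z w → ∣ z *ᶜ w ∣² ≈ʳ ∣ z ∣² *ʳ ∣ w ∣²
∣∣²-* (a +i b) (x +i y) = pointwise λ n → eq (seq a n) (seq b n) (seq x n) (seq y n)
  where
  open +-*-Solver
  eq : ∀ a b x y →
    (a ℚ.* x ℚ.+ ℚ.- (b ℚ.* y)) ℚ.* (a ℚ.* x ℚ.+ ℚ.- (b ℚ.* y)) ℚ.+
    (a ℚ.* y ℚ.+ b ℚ.* x) ℚ.* (a ℚ.* y ℚ.+ b ℚ.* x) ≡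
    (a ℚ.* a ℚ.+ b ℚ.* b) ℚ.* (x ℚ.* x ℚ.+ y ℚ.* y)
  eq = +-*-Solver.solve 4 (λ a b x y →
    (a :* x :+ :- (b :* y)) :* (a :* x :+ :- (b :* y)) :+
    (a :* y :+ b :* x) :* (a :* y :+ b :* x) :=
    (a :* a :+ b :* b) :* (x :* x :+ y :* y)) ≡.refl

fromℝ-∣∣² : ∀ z → fromℝ ∣ z ∣² ≈ᶜ z *ᶜ conj z
fromℝ-∣∣² (x +i y) =
    pointwise (λ n → re-eq (seq x n) (seq y n))
  , pointwise (λ n → im-eq (seq x n) (seq y n))
  where
  open +-*-Solver
  re-eq : ∀ x y → x ℚ.* x ℚ.+ y ℚ.* y ≡ x ℚ.* x ℚ.+ ℚ.- (y ℚ.* (ℚ.- y))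
  re-eq = +-*-Solver.solve 2 (λ x y → x :* x :+ y :* y := x :* x :+ :- (y :* (:- y))) ≡.refl
  im-eq : ∀ x y → 0ℚ ≡ x ℚ.* (ℚ.- y) ℚ.+ y ℚ.* x
  im-eq = +-*-Solver.solve 2 (λ x y → con 0ℚ := x :* (:- y) :+ y :* x) ≡.refl

-- The norm is multiplicative and vanishes only at 0, so the claim descends to the reals.
*ᶜ-cancel-zero : ∀ {z w} → z *ᶜ w ≈ᶜ 0ᶜ → ¬ z ≈ᶜ 0ᶜ → w ≈ᶜ 0ᶜ
*ᶜ-cancel-zero {z} {w} zw≈0 z≉0 = ∣∣²≈0⇒≈0 (*ʳ-cancel-zero
  (ℝR.trans (ℝR.sym (∣∣²-* z w)) (ℝR.trans (∣∣²-cong zw≈0) ∣0∣²≈0))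
  (z≉0 ∘ ∣∣²≈0⇒≈0))

≈0ᶜ-stable : ∀ {z} → ¬ ¬ z ≈ᶜ 0ᶜ → z ≈ᶜ 0ᶜ
≈0ᶜ-stable ¬¬z≈0 = ≈0-stable (λ ¬p → ¬¬z≈0 λ (p , _) → ¬p p)
                 , ≈0-stable (λ ¬q → ¬¬z≈0 λ (_ , q) → ¬q q)

1≉0 : ¬ 1ᶜ ≈ᶜ 0ᶜ
1≉0 (1≈0 , _) with ≈0⇒below 1≈0 1ℚ (ℚ.positive⁻¹ 1ℚ)
... | N , below = ℚ.<-irrefl ≡.refl (below N ℕ.≤-refl)

-- Cancel w in (z - 1)w = 0. Both the modulus of a character and the triviality of χ on the
-- stabiliser of w are obtained from an equation of this shape.
scaling≈1 : ∀ {z w} → ¬ w ≈ᶜ 0ᶜ → z *ᶜ w ≈ᶜ w → z ≈ᶜ 1ᶜ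
scaling≈1 {z} {w} w≉0 zw≈w = x∙y⁻¹≈ε⇒x≈y z 1ᶜ (*ᶜ-cancel-zero eq w≉0)
  where
  open GroupProperties ℂR.+-group using (x∙y⁻¹≈ε⇒x≈y)
  open RingProperties ℂR.ring using (-1*x≈-x)
  open SetoidReasoning ℂR.setoid
  eq : w *ᶜ (z +ᶜ -ᶜ 1ᶜ) ≈ᶜ 0ᶜ
  eq = begin
    w *ᶜ (z +ᶜ -ᶜ 1ᶜ)       ≈⟨ ℂR.*-comm w (z +ᶜ -ᶜ 1ᶜ) ⟩
    (z +ᶜ -ᶜ 1ᶜ) *ᶜ w       ≈⟨ ℂR.distribʳ w z (-ᶜ 1ᶜ) ⟩
    z *ᶜ w +ᶜ -ᶜ 1ᶜ *ᶜ w    ≈⟨ ℂR.+-cong zw≈w (-1*x≈-x w) ⟩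
    w +ᶜ -ᶜ w               ≈⟨ ℂR.-‿inverseʳ w ⟩
    0ᶜ                      ∎

conj-sum : ∀ {n} (z : Fin n → ℂ) → conj (sum z) ≈ᶜ sum (conj ∘ z)
conj-sum {0}       z = ℝR.refl , pointwise λ _ → ≡.refl
conj-sum {ℕ.suc n} z = ℂR.trans (conj-+ (z zero) (sum (z ∘ suc))) (ℂR.+-congˡ (conj-sum (z ∘ suc)))
  where
  conj-+ : ∀ z w → conj (z +ᶜ w) ≈ᶜ conj z +ᶜ conj w
  conj-+ z w = ℝR.refl , pointwise λ n → ℚ.neg-distrib-+ (seq (im z) n) (seq (im w) n)

private
  ∑∣_∣² : ∀ {n} → (Fin n → ℂ) → ℂ
  ∑∣ z ∣² = sum λ i → fromℝ ∣ z i ∣²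

  ∑∣∣²-nonNegative : ∀ {n} (z : Fin n → ℂ) → NonNegative (re ∑∣ z ∣²)
  ∑∣∣²-nonNegative {0}       z _ = ℚ.≤-refl
  ∑∣∣²-nonNegative {ℕ.suc n} z = +-nonNegative {∣ z zero ∣²} {re ∑∣ z ∘ suc ∣²}
    (∣∣²-nonNegative (z zero)) (∑∣∣²-nonNegative (z ∘ suc))

∑∣∣²≈0⇒≈0 : ∀ {n} (z : Fin n → ℂ) → (sum λ i → fromℝ ∣ z i ∣²) ≈ᶜ 0ᶜ → ∀ i → z i ≈ᶜ 0ᶜ
∑∣∣²≈0⇒≈0 z (eq , _) zero =
  ∣∣²≈0⇒≈0 (x+y≈0⇒x≈0 (∣∣²-nonNegative (z zero)) (∑∣∣²-nonNegative (z ∘ suc)) eq)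
∑∣∣²≈0⇒≈0 z (eq , _) (suc i) = ∑∣∣²≈0⇒≈0 (z ∘ suc)
  ( x+y≈0⇒y≈0 (∣∣²-nonNegative (z zero)) (∑∣∣²-nonNegative (z ∘ suc)) eq
  , im≈0 (z ∘ suc)) i
  where
  im≈0 : ∀ {n} (z : Fin n → ℂ) → im ∑∣ z ∣² ≈ʳ 0ʳ
  im≈0 {0}       z = ℝR.refl
  im≈0 {ℕ.suc n} z = ℝR.trans (ℝR.+-identityˡ _) (im≈0 (z ∘ suc))

-- The family z stands for the values of a character; multiplying its argument
-- by a fixed element permutes the values and rescales them by r.
unimodular : ∀ {n} (z : Fin n → ℂ) r i → ¬ z i ≈ᶜ 0ᶜ →
             (sum λ i → fromℝ ∣ r *ᶜ z i ∣²) ≈ᶜ (sum λ i → fromℝ ∣ z i ∣²) →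
             r *ᶜ conj r ≈ᶜ 1ᶜ
unimodular z r i zᵢ≉0 invariant = scaling≈1 (λ eq → zᵢ≉0 (∑∣∣²≈0⇒≈0 z eq i)) (begin
  r *ᶜ conj r *ᶜ ∑∣ z ∣²                      ≈⟨ *-distribˡ-sum (r *ᶜ conj r) (λ i → fromℝ ∣ z i ∣²) ⟩
  sum (λ i → r *ᶜ conj r *ᶜ fromℝ ∣ z i ∣²)   ≈⟨ sum-cong-≋ (λ i → scale (z i)) ⟨
  sum (λ i → fromℝ ∣ r *ᶜ z i ∣²)             ≈⟨ invariant ⟩
  ∑∣ z ∣²                                     ∎)
  where
  open SetoidReasoning ℂR.setoid
  open CommutativeSemigroupProperties ℂR.*-commutativeSemigroup using (interchange)
  scale : ∀ z → fromℝ ∣ r *ᶜ z ∣² ≈ᶜ r *ᶜ conj r *ᶜ fromℝ ∣ z ∣²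
  scale z = begin
    fromℝ ∣ r *ᶜ z ∣²                ≈⟨ fromℝ-∣∣² (r *ᶜ z) ⟩
    r *ᶜ z *ᶜ conj (r *ᶜ z)          ≈⟨ ℂR.*-congˡ (conj-* r z) ⟩
    r *ᶜ z *ᶜ (conj r *ᶜ conj z)     ≈⟨ interchange r z (conj r) (conj z) ⟩
    r *ᶜ conj r *ᶜ (z *ᶜ conj z)     ≈⟨ ℂR.*-congˡ (fromℝ-∣∣² z) ⟨
    r *ᶜ conj r *ᶜ fromℝ ∣ z ∣²      ∎

-- Sums over the unit group

sum-single : ∀ {n} (t : Fin n → ℂ) i → (∀ j → j ≢ i → t j ≈ᶜ 0ᶜ) → sum t ≈ᶜ t i
sum-single {ℕ.suc n} t i t≈0 = begin
  sum t                                 ≈⟨ sum-remove t ⟩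
  t i +ᶜ sum (λ j → t (punchIn i j))    ≈⟨ ℂR.+-congˡ (sum-cong-≋ λ j → t≈0 (punchIn i j) (punchInᵢ≢i i j)) ⟩
  t i +ᶜ sum {n} (λ _ → 0ᶜ)             ≈⟨ ℂR.+-congˡ (sum-replicate-zero n) ⟩
  t i +ᶜ 0ᶜ                             ≈⟨ ℂR.+-identityʳ (t i) ⟩
  t i                                   ∎
  where open SetoidReasoning ℂR.setoid

module UnitSum {c ℓ} (R : CommutativeRing c ℓ) (finite : IsFinite R) where
  open CommutativeRing R
  open AbelianGroup (unitGroup R) using (_∙_)
  open Inverse (proj₂ finite) using (to; from; to-cong; strictlyInverseˡ; strictlyInverseʳ)
  private
    module ≈ᶜ = SetoidReasoning ℂR.setoid

  ∑ : (Unit R → ℂ) → ℂ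
  ∑ = ∑ˣ R finite

  extend : (Unit R → ℂ) → Carrier → ℂ
  extend f x = extendByZero R finite f x (invertible? R finite x)

  Respectful : (Unit R → ℂ) → Set _
  Respectful f = ∀ {u v} → proj₁ u ≈ proj₁ v → f u ≈ᶜ f v

  sum-reindex : (g : Carrier → ℂ) → (∀ {x y} → x ≈ y → g x ≈ᶜ g y) →
                (σ σ⁻¹ : Carrier → Carrier) →
                (∀ {x y} → x ≈ y → σ x ≈ σ y) → (∀ {x y} → x ≈ y → σ⁻¹ x ≈ σ⁻¹ y) →
                (∀ x → σ (σ⁻¹ x) ≈ x) → (∀ x → σ⁻¹ (σ x) ≈ x) →
                sum (g ∘ σ ∘ from) ≈ᶜ sum (g ∘ from)
  sum-reindex g g-cong σ σ⁻¹ σ-cong σ⁻¹-cong invˡ invʳ = begin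
    sum (g ∘ σ ∘ from)              ≈⟨ sum-cong-≋ (λ i → g-cong (strictlyInverseʳ (σ (from i)))) ⟨
    sum (g ∘ from ∘ to ∘ σ ∘ from)  ≈⟨ sum-permute (g ∘ from) π ⟨
    sum (g ∘ from)                  ∎
    where
    open ≈ᶜ
    -- Transport to `Fin` makes the inverse laws strict equalities; general f and h let one proof
    -- serve both directions.
    conjugated : ∀ f h → (∀ {x y} → x ≈ y → f x ≈ f y) → (∀ x → f (h x) ≈ x) → ∀ i →
                 to (f (from (to (h (from i))))) ≡ i
    conjugated f h f-cong inv i = ≡.trans
      (to-cong (trans (f-cong (strictlyInverseʳ (h (from i)))) (inv (from i))))
      (strictlyInverseˡ i)
    π = permutation (to ∘ σ ∘ from) (to ∘ σ⁻¹ ∘ from)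
      (conjugated σ σ⁻¹ σ-cong invˡ) (conjugated σ⁻¹ σ σ⁻¹-cong invʳ)

  -- The decisions p and q are arbitrary, since those at x and at y need not carry the same inverse;
  -- this also allows splitting on them directly.
  extendByZero-cong : ∀ {f g} → (∀ {u v} → proj₁ u ≈ proj₁ v → f u ≈ᶜ g v) →
                      ∀ {x y} → x ≈ y → ∀ p q →
                      extendByZero R finite f x p ≈ᶜ extendByZero R finite g y q
  extendByZero-cong f≈g x≈y (yes _) (yes _) = f≈g x≈y
  extendByZero-cong f≈g x≈y (no _)  (no _)  = ℂR.refl
  extendByZero-cong f≈g x≈y (yes (x⁻¹ , l , r)) (no ¬q) = contradiction
    (x⁻¹ , trans (*-congˡ (sym x≈y)) l , trans (*-congʳ (sym x≈y)) r) ¬q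
  extendByZero-cong f≈g x≈y (no ¬p) (yes (y⁻¹ , l , r)) = contradiction
    (y⁻¹ , trans (*-congˡ x≈y) l , trans (*-congʳ x≈y) r) ¬p

  extendByZero-map : ∀ {f} (h : ℂ → ℂ) → h 0ᶜ ≈ᶜ 0ᶜ → ∀ x p →
                     extendByZero R finite (h ∘ f) x p ≈ᶜ h (extendByZero R finite f x p)
  extendByZero-map h h0≈0 x (yes _) = ℂR.refl
  extendByZero-map h h0≈0 x (no _)  = ℂR.sym h0≈0

  ∑-cong : ∀ {f g} → (∀ u → f u ≈ᶜ g u) → ∑ f ≈ᶜ ∑ g
  ∑-cong {f} {g} f≈g = sum-cong-≋ λ i → extend-cong (from i) (invertible? R finite (from i))
    where
    extend-cong : ∀ x p → extendByZero R finite f x p ≈ᶜ extendByZero R finite g x p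
    extend-cong x (yes inv) = f≈g (x , inv)
    extend-cong x (no _)    = ℂR.refl

  ∑-distribˡ : ∀ z f → z *ᶜ ∑ f ≈ᶜ ∑ (λ u → z *ᶜ f u)
  ∑-distribˡ z f = ℂR.trans (*-distribˡ-sum z (extend f ∘ from))
    (sum-cong-≋ λ i → ℂR.sym (extendByZero-map (z *ᶜ_) (ℂR.zeroʳ z) (from i) (invertible? R finite (from i))))

  ∑-distribʳ : ∀ z f → ∑ f *ᶜ z ≈ᶜ ∑ (λ u → f u *ᶜ z)
  ∑-distribʳ z f = ℂR.trans (*-distribʳ-sum z (extend f ∘ from))
    (sum-cong-≋ λ i → ℂR.sym (extendByZero-map (_*ᶜ z) (ℂR.zeroˡ z) (from i) (invertible? R finite (from i))))

  ∑-* : ∀ f g → ∑ f *ᶜ ∑ g ≈ᶜ ∑ λ u → ∑ λ v → f u *ᶜ g v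
  ∑-* f g = ℂR.trans (∑-distribʳ (∑ g) f) (∑-cong λ u → ∑-distribˡ (f u) g)

  conj-∑ : ∀ f → conj (∑ f) ≈ᶜ ∑ (conj ∘ f)
  conj-∑ f = ℂR.trans (conj-sum (extend f ∘ from))
    (sum-cong-≋ λ i → ℂR.sym (extendByZero-map conj conj-0 (from i) (invertible? R finite (from i))))
    where
    conj-0 : conj 0ᶜ ≈ᶜ 0ᶜ
    conj-0 = conj-sum {0} λ ()

  ∑-swap : (f : Unit R → Unit R → ℂ) → (∑ λ u → ∑ λ v → f u v) ≈ᶜ (∑ λ v → ∑ λ u → f u v)
  ∑-swap f = begin
    (∑ λ u → ∑ λ v → f u v)
      ≈⟨ sum-cong-≋ (λ i → push f (from i) (unit? i)) ⟩
    (sum λ i → sum λ j → at₂ f (from i) (unit? i) (from j) (unit? j))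
      ≈⟨ ∑-comm (λ i j → at₂ f (from i) (unit? i) (from j) (unit? j)) ⟩
    (sum λ j → sum λ i → at₂ f (from i) (unit? i) (from j) (unit? j))
      ≈⟨ sum-cong-≋ (λ j → sum-cong-≋ λ i → exchange (from i) (unit? i) (from j) (unit? j)) ⟩
    (sum λ j → sum λ i → at₂ (λ v u → f u v) (from j) (unit? j) (from i) (unit? i))
      ≈⟨ sum-cong-≋ (λ j → push (λ v u → f u v) (from j) (unit? j)) ⟨
    (∑ λ v → ∑ λ u → f u v) ∎
    where
    open ≈ᶜ
    unit? = λ i → invertible? R finite (from i)
    -- Both extensions by zero are moved into the summand, so that the exchange of plain finite sums
    -- applies.
    at₂ : (Unit R → Unit R → ℂ) → ∀ x → Dec (Invertible _≈_ 1# _*_ x) →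
          ∀ y → Dec (Invertible _≈_ 1# _*_ y) → ℂ
    at₂ f x p y q = extendByZero R finite (λ u → extendByZero R finite (f u) y q) x p
    push : ∀ f x p → extendByZero R finite (λ u → ∑ (f u)) x p ≈ᶜ
                     (sum λ j → at₂ f x p (from j) (unit? j))
    push f x (yes _) = ℂR.refl
    push f x (no _)  = ℂR.sym (sum-replicate-zero (proj₁ finite))
    exchange : ∀ x p y q → at₂ f x p y q ≈ᶜ at₂ (λ v u → f u v) y q x p
    exchange x (yes _) y (yes _) = ℂR.refl
    exchange x (yes _) y (no _)  = ℂR.refl
    exchange x (no _)  y (yes _) = ℂR.refl
    exchange x (no _)  y (no _)  = ℂR.refl

  -- Multiplication by a unit permutes the whole ring and preserves units and non-units, so it is
  -- compatible with extension by zero.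
  ∑-shift : ∀ {f} → Respectful f → ∀ t → ∑ (λ u → f (t ∙ u)) ≈ᶜ ∑ f
  ∑-shift {f} f-cong (t , t⁻¹ , l , r) = ℂR.trans
    (sum-cong-≋ λ i → shift (from i) (invertible? R finite (from i)) (invertible? R finite (t * from i)))
    (sum-reindex (extend f)
      (λ {x} {y} x≈y → extendByZero-cong f-cong x≈y (invertible? R finite x) (invertible? R finite y))
      (t *_) (t⁻¹ *_) *-congˡ *-congˡ (cancel r) (cancel l))
    where
    cancel : ∀ {s t} → s * t ≈ 1# → ∀ x → s * (t * x) ≈ x
    cancel {s} {t} st≈1 x = trans (sym (*-assoc s t x)) (trans (*-congʳ st≈1) (*-identityˡ x))
    shift : ∀ x p q → extendByZero R finite (λ u → f ((t , t⁻¹ , l , r) ∙ u)) x p ≈ᶜ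
                      extendByZero R finite f (t * x) q
    shift x (yes _) (yes _) = f-cong refl
    shift x (no _)  (no _)  = ℂR.refl
    shift x (yes (x⁻¹ , p)) (no ¬q) =
      contradiction (proj₂ ((t , t⁻¹ , l , r) ∙ (x , x⁻¹ , p))) ¬q
    shift x (no ¬p) (yes (y , yl , _)) = contradiction (y * t , inv , trans (*-comm x (y * t)) inv) ¬p
      where
      inv : y * t * x ≈ 1#
      inv = trans (*-assoc y t x) yl

  δ : Carrier → Carrier → ℂ
  δ x y = if does (_≈?_ R finite x y) then 1ᶜ else 0ᶜ

  δ-cong : ∀ {x y x′ y′} → (x ≈ y → x′ ≈ y′) → (x′ ≈ y′ → x ≈ y) → δ x y ≈ᶜ δ x′ y′
  δ-cong {x} {y} {x′} {y′} there back = ℂR.reflexive (≡.cong (λ b → if b then 1ᶜ else 0ᶜ)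
    (does-⇔ (mk⇔ there back) (_≈?_ R finite x y) (_≈?_ R finite x′ y′)))

  δ-equal : ∀ {x y} → x ≈ y → δ x y ≈ᶜ 1ᶜ
  δ-equal {x} {y} x≈y = ℂR.reflexive (≡.cong (λ b → if b then 1ᶜ else 0ᶜ)
    (dec-true (_≈?_ R finite x y) x≈y))

  δ-unequal : ∀ {x y} → ¬ x ≈ y → δ x y ≈ᶜ 0ᶜ
  δ-unequal {x} {y} x≉y = ℂR.reflexive (≡.cong (λ b → if b then 1ᶜ else 0ᶜ)
    (dec-false (_≈?_ R finite x y) x≉y))

  -- Only the unit equal to x survives, and none does when x is a non-unit. Applied to x = u + v,
  -- this introduces the summation variable c.
  extend-as-∑ : ∀ {f} → Respectful f → ∀ x → extend f x ≈ᶜ ∑ (λ u → δ x (proj₁ u) *ᶜ f u)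
  extend-as-∑ {f} f-cong x = begin
    extend f x
      ≈⟨ extendByZero-cong f-cong (strictlyInverseʳ x) (unit? (from (to x))) (unit? x) ⟨
    extend f (from (to x))
      ≈⟨ diagonal (from (to x)) (unit? (from (to x))) (sym (strictlyInverseʳ x)) ⟨
    extend (λ u → δ x (proj₁ u) *ᶜ f u) (from (to x))
      ≈⟨ sum-single _ (to x) (λ j j≢ → off-diagonal (from j) (unit? (from j)) (x≉from j≢)) ⟨
    ∑ (λ u → δ x (proj₁ u) *ᶜ f u) ∎
    where
    open ≈ᶜ
    unit? = invertible? R finite
    x≉from : ∀ {j} → j ≢ to x → ¬ x ≈ from j
    x≉from j≢ x≈ = j≢ (≡.sym (≡.trans (to-cong x≈) (strictlyInverseˡ _)))
    diagonal : ∀ y p → x ≈ y →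
      extendByZero R finite (λ u → δ x (proj₁ u) *ᶜ f u) y p ≈ᶜ extendByZero R finite f y p
    diagonal y (yes _) x≈y = ℂR.trans (ℂR.*-congʳ (δ-equal x≈y)) (ℂR.*-identityˡ _)
    diagonal y (no _)  x≈y = ℂR.refl
    off-diagonal : ∀ y p → ¬ x ≈ y →
      extendByZero R finite (λ u → δ x (proj₁ u) *ᶜ f u) y p ≈ᶜ 0ᶜ
    off-diagonal y (yes _) x≉y = ℂR.trans (ℂR.*-congʳ (δ-unequal x≉y)) (ℂR.zeroˡ _)
    off-diagonal y (no _)  x≉y = ℂR.refl

-- Twisted Gauss sums and the product of two Kloosterman sums

module CharacterSums {c ℓ} (R : CommutativeRing c ℓ) (finite : IsFinite R)
                     (ψ : AdditiveCharacter R) where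
  open CommutativeRing R
  open AbelianGroup (unitGroup R) using (_∙_; _⁻¹; ε)
  open UnitSum R finite
  open CommutativeSemigroupProperties *-commutativeSemigroup using (x∙yz≈y∙xz)
  open CommutativeMonoidSolver ℂR.*-commutativeMonoid using (solve; _⊜_; _⊕_)
  private
    module ≈ᶜ = SetoidReasoning ℂR.setoid

  K : MultiplicativeCharacter R → Unit R → ℂ
  K = kloosterman R finite ψ

  G : MultiplicativeCharacter R → ℂ
  G = gauss R finite ψ

  -- This is S(w) of the overview; w ranges over the whole ring because sums u + v of units need not
  -- be units.
  twistedGauss : MultiplicativeCharacter R → Carrier → ℂ
  twistedGauss χ w = ∑ λ b → χ at b *ᶜ ψ at (proj₁ b * w)

  private
    χψ-cong : ∀ (χ : MultiplicativeCharacter R) {u v x y} → proj₁ u ≈ proj₁ v → x ≈ y →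
              χ at u *ᶜ ψ at x ≈ᶜ χ at v *ᶜ ψ at y
    χψ-cong χ u≈v x≈y = ℂR.*-cong (⟦⟧-cong χ u≈v) (⟦⟧-cong ψ x≈y)

    ψ[xu+xv] : ∀ x u v → ψ at (x * (u + v)) ≈ᶜ ψ at (x * u) *ᶜ ψ at (x * v)
    ψ[xu+xv] x u v = ℂR.trans (⟦⟧-cong ψ (distribˡ x u v)) (homo ψ (x * u) (x * v))

  -- Substitute tb for b. With t the inverse of a unit w this evaluates S(w); with tw = w it becomes
  -- an equation S(w) = χ(t)S(w).
  twistedGauss-shift : ∀ χ t w → twistedGauss χ w ≈ᶜ χ at t *ᶜ twistedGauss χ (proj₁ t * w)
  twistedGauss-shift χ t w = begin
    (∑ λ b → χ at b *ᶜ ψ at (proj₁ b * w))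
      ≈⟨ ∑-shift (λ u≈v → χψ-cong χ u≈v (*-congʳ u≈v)) t ⟨
    (∑ λ b → χ at (t ∙ b) *ᶜ ψ at (proj₁ t * proj₁ b * w))
      ≈⟨ ∑-cong (λ b → ℂR.trans
           (ℂR.*-cong (homo χ t b) (⟦⟧-cong ψ
             (trans (*-assoc (proj₁ t) (proj₁ b) w) (x∙yz≈y∙xz (proj₁ t) (proj₁ b) w))))
           (ℂR.*-assoc (χ at t) (χ at b) (ψ at (proj₁ b * (proj₁ t * w))))) ⟩
    (∑ λ b → χ at t *ᶜ (χ at b *ᶜ ψ at (proj₁ b * (proj₁ t * w))))
      ≈⟨ ∑-distribˡ (χ at t) (λ b → χ at b *ᶜ ψ at (proj₁ b * (proj₁ t * w))) ⟨
    χ at t *ᶜ twistedGauss χ (proj₁ t * w) ∎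
    where open ≈ᶜ

  twistedGauss-unit : ∀ χ (w : Unit R) → twistedGauss χ (proj₁ w) ≈ᶜ χ at (w ⁻¹) *ᶜ G χ
  twistedGauss-unit χ w@(_ , w⁻¹ , w⁻¹w≈1 , _) = begin
    twistedGauss χ (proj₁ w)
      ≈⟨ twistedGauss-shift χ (w ⁻¹) (proj₁ w) ⟩
    χ at (w ⁻¹) *ᶜ twistedGauss χ (w⁻¹ * proj₁ w)
      ≈⟨ ℂR.*-congˡ (∑-cong λ b → ℂR.trans
           (χψ-cong χ {b} {b} refl (trans (*-congˡ w⁻¹w≈1) (*-identityʳ (proj₁ b))))
           (ℂR.*-comm (χ at b) (ψ at proj₁ b))) ⟩
    χ at (w ⁻¹) *ᶜ G χ ∎
    where open ≈ᶜ

  -- Locality of R and primitivity of χ enter the product formula only through `vanishing`, which is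
  -- supplied later.
  module _ (τ η χ : MultiplicativeCharacter R)
           (vanishing : ∀ w → ¬ Invertible _≈_ 1# _*_ w → twistedGauss χ w ≈ᶜ 0ᶜ) where

    private
      -- The value of ψ(w)S(w) at a unit w. By `vanishing`, its extension by zero is ψ(w)S(w) on all
      -- of R.
      φ : Unit R → ℂ
      φ w = ψ at proj₁ w *ᶜ (χ at (w ⁻¹) *ᶜ G χ)

      ⁻¹-cong = AbelianGroup.⁻¹-cong (unitGroup R)

      φ-cong : Respectful φ
      φ-cong {u} {v} u≈v = ℂR.*-cong (⟦⟧-cong ψ u≈v)
        (ℂR.*-congʳ (⟦⟧-cong χ {u ⁻¹} {v ⁻¹} (⁻¹-cong {u} {v} u≈v)))

      ψ-twistedGauss : ∀ w → ψ at w *ᶜ twistedGauss χ w ≈ᶜ ∑ (λ c → δ w (proj₁ c) *ᶜ φ c)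
      ψ-twistedGauss w = ℂR.trans (by-cases (invertible? R finite w)) (extend-as-∑ φ-cong w)
        where
        by-cases : ∀ p → ψ at w *ᶜ twistedGauss χ w ≈ᶜ extendByZero R finite φ w p
        by-cases (yes inv)   = ℂR.*-congˡ (twistedGauss-unit χ (w , inv))
        by-cases (no ¬inv)   = ℂR.trans (ℂR.*-congˡ (vanishing w ¬inv)) (ℂR.zeroʳ (ψ at w))

      term : Unit R → Unit R → Unit R → ℂ
      term a u v = χ at a *ᶜ
        ( τ at u *ᶜ ψ at (proj₁ u + proj₁ a * proj₁ (u ⁻¹))
        *ᶜ (η at v *ᶜ ψ at (proj₁ v + proj₁ a * proj₁ (v ⁻¹))))

      term-cong : ∀ u v → Respectful λ a → term a u v
      term-cong u v a≈b = ℂR.*-cong (⟦⟧-cong χ a≈b) (ℂR.*-cong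
        (ℂR.*-congˡ (⟦⟧-cong ψ (+-congˡ (*-congʳ a≈b))))
        (ℂR.*-congˡ (⟦⟧-cong ψ (+-congˡ (*-congʳ a≈b)))))

      coeff : Unit R → Unit R → ℂ
      coeff u v = (χ · τ) at u *ᶜ (χ · η) at v

      coeff-shift : ∀ c u v → coeff (c ∙ u) (c ∙ v) ≈ᶜ
                    (χ · τ) at c *ᶜ (χ · τ) at u *ᶜ ((χ · η) at c *ᶜ (χ · η) at v)
      coeff-shift c u v = ℂR.*-cong (homo (χ · τ) c u) (homo (χ · η) c v)

      term-shift : ∀ a u v → term (u ∙ v ∙ a) u v ≈ᶜ
        coeff u v *ᶜ ψ at (proj₁ u + proj₁ v) *ᶜ
          (χ at a *ᶜ ψ at (proj₁ a * (proj₁ u + proj₁ v)))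
      term-shift a u@(u₀ , u⁻¹ , _ , uu⁻¹≈1) v@(v₀ , v⁻¹ , _ , vv⁻¹≈1) = begin
        term (u ∙ v ∙ a) u v
          -- The partners cross over: after the substitution a/u has become av and a/v has become
          -- au.
          ≈⟨ ℂR.*-cong (ℂR.trans (homo χ (u ∙ v) a) (ℂR.*-congʳ (homo χ u v)))
               (ℂR.*-cong (ℂR.*-congˡ (ψ-split u₀ (a₀ * v₀) cancel-u))
                          (ℂR.*-congˡ (ψ-split v₀ (a₀ * u₀) cancel-v))) ⟩
        χ at u *ᶜ χ at v *ᶜ χ at a *ᶜ
          (τ at u *ᶜ (ψ at u₀ *ᶜ ψ at (a₀ * v₀)) *ᶜ (η at v *ᶜ (ψ at v₀ *ᶜ ψ at (a₀ * u₀))))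
          ≈⟨ rearrange (χ at u) (χ at v) (χ at a) (τ at u) (η at v)
               (ψ at u₀) (ψ at v₀) (ψ at (a₀ * u₀)) (ψ at (a₀ * v₀)) ⟩
        coeff u v *ᶜ (ψ at u₀ *ᶜ ψ at v₀) *ᶜ (χ at a *ᶜ (ψ at (a₀ * u₀) *ᶜ ψ at (a₀ * v₀)))
          ≈⟨ ℂR.*-cong (ℂR.*-congˡ (homo ψ u₀ v₀)) (ℂR.*-congˡ (ψ[xu+xv] a₀ u₀ v₀)) ⟨
        coeff u v *ᶜ ψ at (u₀ + v₀) *ᶜ (χ at a *ᶜ ψ at (a₀ * (u₀ + v₀))) ∎
        where
        open ≈ᶜ
        a₀ = proj₁ a
        ψ-split : ∀ x y {z} → z ≈ y → ψ at (x + z) ≈ᶜ ψ at x *ᶜ ψ at y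
        ψ-split x y z≈y = ℂR.trans (⟦⟧-cong ψ (+-congˡ z≈y)) (homo ψ x y)
        module Rˢ = CommutativeMonoidSolver *-commutativeMonoid
        cancel : ∀ {x x⁻¹} y → x * x⁻¹ ≈ 1# → x * x⁻¹ * (a₀ * y) ≈ a₀ * y
        cancel y xx⁻¹≈1 = trans (*-congʳ xx⁻¹≈1) (*-identityˡ (a₀ * y))
        cancel-u : u₀ * v₀ * a₀ * u⁻¹ ≈ a₀ * v₀
        cancel-u = trans
          (Rˢ.solve 4 (λ u v a u⁻¹ → ((u Rˢ.⊕ v) Rˢ.⊕ a) Rˢ.⊕ u⁻¹ Rˢ.⊜ (u Rˢ.⊕ u⁻¹) Rˢ.⊕ (a Rˢ.⊕ v))
            refl u₀ v₀ a₀ u⁻¹)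
          (cancel v₀ uu⁻¹≈1)
        cancel-v : u₀ * v₀ * a₀ * v⁻¹ ≈ a₀ * u₀
        cancel-v = trans
          (Rˢ.solve 4 (λ u v a v⁻¹ → ((u Rˢ.⊕ v) Rˢ.⊕ a) Rˢ.⊕ v⁻¹ Rˢ.⊜ (v Rˢ.⊕ v⁻¹) Rˢ.⊕ (a Rˢ.⊕ u))
            refl u₀ v₀ a₀ v⁻¹)
          (cancel u₀ vv⁻¹≈1)
        rearrange : ∀ χu χv χa τu ηv ψu ψv ψau ψav →
          χu *ᶜ χv *ᶜ χa *ᶜ (τu *ᶜ (ψu *ᶜ ψav) *ᶜ (ηv *ᶜ (ψv *ᶜ ψau))) ≈ᶜ
          χu *ᶜ τu *ᶜ (χv *ᶜ ηv) *ᶜ (ψu *ᶜ ψv) *ᶜ (χa *ᶜ (ψau *ᶜ ψav))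
        rearrange = solve 9 (λ χu χv χa τu ηv ψu ψv ψau ψav →
          ((χu ⊕ χv) ⊕ χa) ⊕ ((τu ⊕ (ψu ⊕ ψav)) ⊕ (ηv ⊕ (ψv ⊕ ψau))) ⊜
          (((χu ⊕ τu) ⊕ (χv ⊕ ηv)) ⊕ (ψu ⊕ ψv)) ⊕ (χa ⊕ (ψau ⊕ ψav))) ℂR.refl

      inner : ∀ u v → (∑ λ a → term a u v) ≈ᶜ
              (∑ λ c → coeff u v *ᶜ (δ (proj₁ u + proj₁ v) (proj₁ c) *ᶜ φ c))
      inner u v = begin
        (∑ λ a → term a u v)
          ≈⟨ ∑-shift (term-cong u v) (u ∙ v) ⟨
        (∑ λ a → term (u ∙ v ∙ a) u v)
          ≈⟨ ∑-cong (λ a → term-shift a u v) ⟩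
        (∑ λ a → coeff u v *ᶜ ψ at w *ᶜ (χ at a *ᶜ ψ at (proj₁ a * w)))
          ≈⟨ ∑-distribˡ (coeff u v *ᶜ ψ at w) (λ a → χ at a *ᶜ ψ at (proj₁ a * w)) ⟨
        coeff u v *ᶜ ψ at w *ᶜ twistedGauss χ w
          ≈⟨ ℂR.*-assoc (coeff u v) (ψ at w) (twistedGauss χ w) ⟩
        coeff u v *ᶜ (ψ at w *ᶜ twistedGauss χ w)
          ≈⟨ ℂR.*-congˡ (ψ-twistedGauss w) ⟩
        coeff u v *ᶜ ∑ (λ c → δ w (proj₁ c) *ᶜ φ c)
          ≈⟨ ∑-distribˡ (coeff u v) (λ c → δ w (proj₁ c) *ᶜ φ c) ⟩
        (∑ λ c → coeff u v *ᶜ (δ w (proj₁ c) *ᶜ φ c)) ∎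
        where
        open ≈ᶜ
        w = proj₁ u + proj₁ v

      J-term : Unit R → Unit R → ℂ
      J-term u v = if does (_≈?_ R finite (proj₁ u + proj₁ v) 1#)
        then (χ · τ) at u *ᶜ (χ · η) at v else 0ᶜ

      J-term-as-δ : ∀ u v → δ (proj₁ u + proj₁ v) 1# *ᶜ coeff u v ≈ᶜ J-term u v
      J-term-as-δ u v with does (_≈?_ R finite (proj₁ u + proj₁ v) 1#)
      ... | true  = ℂR.*-identityˡ (coeff u v)
      ... | false = ℂR.zeroˡ (coeff u v)

      G-term : Unit R → ℂ
      G-term c = ψ at (proj₁ c) *ᶜ (χ · τ · η) at c

      -- Scaling u and v by c contributes (χτ)(c)(χη)(c), while `φ c` contributes χ(c)⁻¹. One factor
      -- χ(c) cancels and (χτη)(c) remains, the character of the first Gauss sum. The condition cu +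
      -- cv = c becomes u + v = 1 since c is a unit.
      outer-term : ∀ c u v →
        coeff (c ∙ u) (c ∙ v) *ᶜ (δ (proj₁ (c ∙ u) + proj₁ (c ∙ v)) (proj₁ c) *ᶜ φ c) ≈ᶜ
        G-term c *ᶜ G χ *ᶜ J-term u v
      outer-term c@(c₀ , c⁻¹ , c⁻¹c≈1 , cc⁻¹≈1) u v = begin
        coeff (c ∙ u) (c ∙ v) *ᶜ (δ (c₀ * proj₁ u + c₀ * proj₁ v) c₀ *ᶜ φ c)
          ≈⟨ ℂR.*-cong (coeff-shift c u v) (ℂR.*-congʳ (δ-cong divide multiply)) ⟩
        (χ · τ) at c *ᶜ (χ · τ) at u *ᶜ ((χ · η) at c *ᶜ (χ · η) at v) *ᶜ
          (δ w 1# *ᶜ (ψ at c₀ *ᶜ (χ at (c ⁻¹) *ᶜ G χ)))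
          ≈⟨ rearrange (χ at c) (χ at (c ⁻¹)) (τ at c) (η at c) ((χ · τ) at u) ((χ · η) at v)
               (δ w 1#) (ψ at c₀) (G χ) ⟩
        χ at c *ᶜ χ at (c ⁻¹) *ᶜ (G-term c *ᶜ G χ *ᶜ (δ w 1# *ᶜ coeff u v))
          ≈⟨ ℂR.*-cong χχ⁻¹≈1 (ℂR.*-congˡ (J-term-as-δ u v)) ⟩
        1ᶜ *ᶜ (G-term c *ᶜ G χ *ᶜ J-term u v)
          ≈⟨ ℂR.*-identityˡ (G-term c *ᶜ G χ *ᶜ J-term u v) ⟩
        G-term c *ᶜ G χ *ᶜ J-term u v ∎
        where
        open ≈ᶜ
        w = proj₁ u + proj₁ v
        χχ⁻¹≈1 : χ at c *ᶜ χ at (c ⁻¹) ≈ᶜ 1ᶜ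
        χχ⁻¹≈1 = ℂR.trans (ℂR.sym (homo χ c (c ⁻¹)))
          (ℂR.trans (⟦⟧-cong χ {c ∙ c ⁻¹} {ε} cc⁻¹≈1) (ε-homo χ))
        divide : c₀ * proj₁ u + c₀ * proj₁ v ≈ c₀ → w ≈ 1#
        divide eq = trans (sym (*-identityˡ w)) (trans (*-congʳ (sym c⁻¹c≈1))
          (trans (*-assoc c⁻¹ c₀ w) (trans (*-congˡ (trans (distribˡ c₀ (proj₁ u) (proj₁ v)) eq)) c⁻¹c≈1)))
        multiply : w ≈ 1# → c₀ * proj₁ u + c₀ * proj₁ v ≈ c₀
        multiply w≈1 = trans (sym (distribˡ c₀ (proj₁ u) (proj₁ v))) (trans (*-congˡ w≈1) (*-identityʳ c₀))
        rearrange : ∀ χc χc⁻¹ τc ηc x y d ψc g →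
          χc *ᶜ τc *ᶜ x *ᶜ (χc *ᶜ ηc *ᶜ y) *ᶜ (d *ᶜ (ψc *ᶜ (χc⁻¹ *ᶜ g))) ≈ᶜ
          χc *ᶜ χc⁻¹ *ᶜ (ψc *ᶜ (χc *ᶜ τc *ᶜ ηc) *ᶜ g *ᶜ (d *ᶜ (x *ᶜ y)))
        rearrange = solve 9 (λ χc χc⁻¹ τc ηc x y d ψc g →
          ((((χc ⊕ τc) ⊕ x) ⊕ ((χc ⊕ ηc) ⊕ y)) ⊕ (d ⊕ (ψc ⊕ (χc⁻¹ ⊕ g)))) ⊜
          ((χc ⊕ χc⁻¹) ⊕ (((ψc ⊕ ((χc ⊕ τc) ⊕ ηc)) ⊕ g) ⊕ (d ⊕ (x ⊕ y))))) ℂR.refl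

      outer : ∀ c → (∑ λ u → ∑ λ v → coeff u v *ᶜ (δ (proj₁ u + proj₁ v) (proj₁ c) *ᶜ φ c)) ≈ᶜ
              G-term c *ᶜ G χ *ᶜ jacobi R finite (χ · τ) (χ · η)
      outer c = begin
        (∑ λ u → ∑ λ v → H u v)
          ≈⟨ ∑-shift (λ u≈u′ → ∑-cong λ v → H-cong {v = v} u≈u′ refl) c ⟨
        (∑ λ u → ∑ λ v → H (c ∙ u) v)
          ≈⟨ ∑-cong (λ u → ∑-shift (λ v≈v′ → H-cong {u = c ∙ u} refl v≈v′) c) ⟨
        (∑ λ u → ∑ λ v → H (c ∙ u) (c ∙ v))
          ≈⟨ ∑-cong (λ u → ℂR.trans (∑-cong (outer-term c u)) (ℂR.sym (∑-distribˡ (G-term c *ᶜ G χ) (J-term u)))) ⟩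
        (∑ λ u → G-term c *ᶜ G χ *ᶜ ∑ (J-term u))
          ≈⟨ ∑-distribˡ (G-term c *ᶜ G χ) (λ u → ∑ (J-term u)) ⟨
        G-term c *ᶜ G χ *ᶜ jacobi R finite (χ · τ) (χ · η) ∎
        where
        open ≈ᶜ
        H : Unit R → Unit R → ℂ
        H u v = coeff u v *ᶜ (δ (proj₁ u + proj₁ v) (proj₁ c) *ᶜ φ c)
        H-cong : ∀ {u u′ v v′} → proj₁ u ≈ proj₁ u′ → proj₁ v ≈ proj₁ v′ → H u v ≈ᶜ H u′ v′
        H-cong u≈ v≈ = ℂR.*-cong
          (ℂR.*-cong (⟦⟧-cong (χ · τ) u≈) (⟦⟧-cong (χ · η) v≈))
          (ℂR.*-congʳ (δ-cong (trans (+-cong (sym u≈) (sym v≈))) (trans (+-cong u≈ v≈))))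

    -- The order of summation carries the proof: a has to be innermost for its sum to become S(u +
    -- v), and then c outermost so that u and v can be scaled by it.
    kloosterman-product : (∑ λ a → χ at a *ᶜ (K τ a *ᶜ K η a)) ≈ᶜ
                          G (χ · τ · η) *ᶜ G χ *ᶜ jacobi R finite (χ · τ) (χ · η)
    kloosterman-product = begin
      (∑ λ a → χ at a *ᶜ (K τ a *ᶜ K η a))
        ≈⟨ ∑-cong expand ⟩
      (∑ λ a → ∑ λ u → ∑ λ v → term a u v)
        ≈⟨ ∑-swap (λ a u → ∑ λ v → term a u v) ⟩
      (∑ λ u → ∑ λ a → ∑ λ v → term a u v)
        ≈⟨ ∑-cong (λ u → ∑-swap (λ a v → term a u v)) ⟩
      (∑ λ u → ∑ λ v → ∑ λ a → term a u v)
        ≈⟨ ∑-cong (λ u → ∑-cong (inner u)) ⟩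
      (∑ λ u → ∑ λ v → ∑ λ c → summand c u v)
        ≈⟨ ∑-cong (λ u → ∑-swap (λ v c → summand c u v)) ⟩
      (∑ λ u → ∑ λ c → ∑ λ v → summand c u v)
        ≈⟨ ∑-swap (λ u c → ∑ λ v → summand c u v) ⟩
      (∑ λ c → ∑ λ u → ∑ λ v → summand c u v)
        ≈⟨ ∑-cong outer ⟩
      (∑ λ c → G-term c *ᶜ G χ *ᶜ J)
        ≈⟨ ∑-distribʳ J (λ c → G-term c *ᶜ G χ) ⟨
      (∑ λ c → G-term c *ᶜ G χ) *ᶜ J
        ≈⟨ ℂR.*-congʳ (∑-distribʳ (G χ) G-term) ⟨
      G (χ · τ · η) *ᶜ G χ *ᶜ J ∎
      where
      open ≈ᶜ
      J = jacobi R finite (χ · τ) (χ · η)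
      summand : Unit R → Unit R → Unit R → ℂ
      summand c u v = coeff u v *ᶜ (δ (proj₁ u + proj₁ v) (proj₁ c) *ᶜ φ c)
      expand : ∀ a → χ at a *ᶜ (K τ a *ᶜ K η a) ≈ᶜ ∑ λ u → ∑ λ v → term a u v
      expand a = begin
        χ at a *ᶜ (K τ a *ᶜ K η a)
          ≈⟨ ℂR.*-congˡ (∑-* (K-term τ) (K-term η)) ⟩
        χ at a *ᶜ (∑ λ u → ∑ λ v → K-term τ u *ᶜ K-term η v)
          ≈⟨ ∑-distribˡ (χ at a) (λ u → ∑ λ v → K-term τ u *ᶜ K-term η v) ⟩
        (∑ λ u → χ at a *ᶜ (∑ λ v → K-term τ u *ᶜ K-term η v))
          ≈⟨ ∑-cong (λ u → ∑-distribˡ (χ at a) (λ v → K-term τ u *ᶜ K-term η v)) ⟩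
        (∑ λ u → ∑ λ v → term a u v) ∎
        where
        K-term : MultiplicativeCharacter R → Unit R → ℂ
        K-term τ u = τ at u *ᶜ ψ at (proj₁ u + proj₁ a * proj₁ (u ⁻¹))

-- Finite rings

-- If i were missed, punching it out would inject `Fin (suc n)` into `Fin n`.
injective⇒surjective : ∀ {n} {f : Fin n → Fin n} → Injective _≡_ _≡_ f → ∀ i → ∃[ j ] f j ≡ i
injective⇒surjective {ℕ.suc n} {f} f-injective i with any? (λ j → f j ≟ᶠ i)
... | yes hit = hit
... | no miss = contradiction (injective⇒≤ {f = λ j → punchOut (i≢f j)} punched-injective) ℕ.1+n≰n
  where
  i≢f : ∀ j → i ≢ f j
  i≢f j i≡fj = miss (j , ≡.sym i≡fj)
  punched-injective : Injective _≡_ _≡_ (λ j → punchOut (i≢f j))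
  punched-injective {j} {k} = f-injective ∘ punchOut-injective (i≢f j) (i≢f k)

module FiniteRing {c ℓ} (R : CommutativeRing c ℓ) (finite : IsFinite R) where
  open CommutativeRing R hiding (zero)
  open Ideal
  open Inverse (proj₂ finite) using (to; from; to-cong; from-cong; strictlyInverseˡ; strictlyInverseʳ)
  open RingProperties ring using (-1*x≈-x; -‿distribˡ-*)
  open CommutativeSemigroupProperties +-commutativeSemigroup using (interchange)
  open GroupProperties +-group using (x∙y⁻¹≈ε⇒x≈y; inverseˡ-unique)

  -- The ideal I + (a). Only the coefficient r is recorded, so membership is decided by a search
  -- over R when I is decidable. The sign is absorbed into r, hence the witness -1 for a itself.
  adjoin : Ideal R → Carrier → Ideal R
  adjoin I a = record
    { member   = λ x → ∃[ r ] x + r * a ∈ member I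
    ; respects = λ x≈y (r , x+ra) → r , respects I (+-congʳ x≈y) x+ra
    ; 0∈       = 0# , respects I (sym (trans (+-identityˡ (0# * a)) (zeroˡ a))) (0∈ I)
    ; +∈       = λ {x} {y} (r , x+ra) (s , y+sa) → r + s , respects I
        (trans (interchange x (r * a) y (s * a)) (+-congˡ (sym (distribʳ a r s))))
        (+∈ I x+ra y+sa)
    ; *∈       = λ b {x} (r , x+ra) → b * r , respects I
        (trans (distribˡ b x (r * a)) (+-congˡ (sym (*-assoc b r a))))
        (*∈ I b x+ra)
    }

  ⊆adjoin : ∀ I a → member I ⊆ member (adjoin I a)
  ⊆adjoin I a {x} x∈I = 0# , respects I (sym (trans (+-congˡ (zeroˡ a)) (+-identityʳ x))) x∈I

  ∈adjoin : ∀ I a → a ∈ member (adjoin I a)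
  ∈adjoin I a = - 1# , respects I (sym (trans (+-congˡ (-1*x≈-x a)) (-‿inverseʳ a))) (0∈ I)

  1∈⇒whole : ∀ I → 1# ∈ member I → IsWhole R I
  1∈⇒whole I 1∈I x = respects I (*-identityʳ x) (*∈ I x 1∈I)

  adjoin? : ∀ I → Unary.Decidable (member I) → ∀ a → Unary.Decidable (member (adjoin I a))
  adjoin? I I? a x = map′
    (λ (i , p) → from i , p)
    (λ (r , p) → to r , respects I (+-congˡ (*-congʳ (sym (strictlyInverseʳ r)))) p)
    (any? λ i → I? (x + from i * a))

  private
    -- `saturated` is maximality as a positive dichotomy. When a enumerates R, it can be used
    -- against any larger ideal J, with no decision about membership in J.
    record Saturation {n} (a : Fin n → Carrier) (I : Ideal R) : Set (Level.suc (c Level.⊔ ℓ)) where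
      field
        ideal     : Ideal R
        proper    : ¬ 1# ∈ member ideal
        extends   : member I ⊆ member ideal
        saturated : ∀ i → a i ∈ member ideal ⊎ 1# ∈ member (adjoin ideal (a i))

    -- Adjoin the a i one after another, skipping those that would generate R.
    saturate : ∀ {n} (a : Fin n → Carrier) (I : Ideal R) → Unary.Decidable (member I) →
               ¬ 1# ∈ member I → Saturation a I
    saturate {0} a I I? 1∉I = record
      { ideal = I ; proper = 1∉I ; extends = λ x∈I → x∈I ; saturated = λ () }
    saturate {ℕ.suc n} a I I? 1∉I with adjoin? I I? (a zero) 1#
    ... | no 1∉ = record
      { ideal     = S.ideal
      ; proper    = S.proper
      ; extends   = S.extends ∘ ⊆adjoin I (a zero)
      ; saturated = λ { zero → inj₁ (S.extends (∈adjoin I (a zero))) ; (suc i) → S.saturated i }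
      }
      where module S = Saturation (saturate (a ∘ suc) (adjoin I (a zero)) (adjoin? I I? (a zero)) 1∉)
    ... | yes (r , 1+ra∈I) = record
      { ideal     = S.ideal
      ; proper    = S.proper
      ; extends   = S.extends
      ; saturated = λ { zero → inj₂ (r , S.extends 1+ra∈I) ; (suc i) → S.saturated i }
      }
      where module S = Saturation (saturate (a ∘ suc) I I? 1∉I)

  -- A finite replacement for Zorn's lemma. If x lies in a proper J above the saturated ideal, then
  -- 1 + rx cannot, since 1 = (1 + rx) - rx would lie in J.
  below-maximal : ∀ I → Unary.Decidable (member I) → ¬ 1# ∈ member I →
                  ∃[ J ] member I ⊆ member J × IsMaximal R J
  below-maximal I I? 1∉I = S.ideal , S.extends , (λ whole → S.proper (whole 1#)) , maximal
    where
    module S = Saturation (saturate from I I? 1∉I)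
    maximal : ∀ J → member S.ideal ⊆ member J → ¬ IsWhole R J → member J ⊆ member S.ideal
    maximal J S⊆J ¬whole {x} x∈J with S.saturated (to x)
    ... | inj₁ x∈S          = respects S.ideal (strictlyInverseʳ x) x∈S
    ... | inj₂ (r , 1+rx∈S) = contradiction (1∈⇒whole J (respects J cancel
        (+∈ J (S⊆J 1+rx∈S) (*∈ J (- r) (respects J (sym (strictlyInverseʳ x)) x∈J))))) ¬whole
      where
      x′ = from (to x)
      cancel : 1# + r * x′ + - r * x′ ≈ 1#
      cancel = trans (+-assoc 1# (r * x′) (- r * x′)) (trans
        (+-congˡ (trans (sym (distribʳ x′ r (- r))) (trans (*-congʳ (-‿inverseʳ r)) (zeroˡ x′))))
        (+-identityʳ 1#))

  -- The ideal (x) is proper, as 1 + rx = 0 would make -r an inverse of x. Locality speaks of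
  -- maximal ideals only, so a maximal ideal above (x) is produced and then identified with the
  -- given one.
  nonunit∈maximal : ∀ (local : IsLocal R) {x} → ¬ Invertible _≈_ 1# _*_ x →
                    x ∈ member (IsLocal.maximalIdeal local)
  nonunit∈maximal local {x} ¬unit with below-maximal (adjoin (zeroIdeal R) x)
    (adjoin? (zeroIdeal R) (λ y → map′ lift lower (_≈?_ R finite y 0#)) x)
    (λ (r , lift 1+rx≈0) → ¬unit (- r , inv r 1+rx≈0 , trans (*-comm x (- r)) (inv r 1+rx≈0)))
    where
    inv : ∀ r → 1# + r * x ≈ 0# → - r * x ≈ 1#
    inv r 1+rx≈0 = trans (sym (-‿distribˡ-* r x)) (sym (inverseˡ-unique 1# (r * x) 1+rx≈0))
  ... | J , x⊆J , J-maximal = proj₁ (IsLocal.unique local J J-maximal) (x⊆J (∈adjoin (zeroIdeal R) x))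

  annihilator : Carrier → Ideal R
  annihilator w = record
    { member   = λ x → Lift c (x * w ≈ 0#)
    ; respects = λ x≈y (lift xw≈0) → lift (trans (*-congʳ (sym x≈y)) xw≈0)
    ; 0∈       = lift (zeroˡ w)
    ; +∈       = λ {x} {y} (lift xw≈0) (lift yw≈0) → lift
        (trans (distribʳ w x y) (trans (+-cong xw≈0 yw≈0) (+-identityˡ 0#)))
    ; *∈       = λ a {x} (lift xw≈0) → lift
        (trans (*-assoc a x w) (trans (*-congˡ xw≈0) (zeroʳ a)))
    }

  -- Multiplication by w is injective, hence surjective on a finite ring, and a preimage of 1 is the
  -- inverse. Read contrapositively, this says Ann(w) ≠ 0 for a non-unit w.
  regular⇒unit : ∀ w → member (annihilator w) ⊆ member (zeroIdeal R) → Invertible _≈_ 1# _*_ w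
  regular⇒unit w regular = from j , inv , trans (*-comm w (from j)) inv
    where
    cancel : ∀ {x y} → x * w ≈ y * w → x ≈ y
    cancel {x} {y} xw≈yw = x∙y⁻¹≈ε⇒x≈y x y (lower (regular {x - y} (lift (trans (distribʳ w x (- y))
      (trans (+-cong xw≈yw (sym (-‿distribˡ-* y w))) (-‿inverseʳ (y * w)))))))
    to-injective : ∀ {x y} → to x ≡ to y → x ≈ y
    to-injective {x} {y} eq =
      trans (sym (strictlyInverseʳ x)) (trans (from-cong eq) (strictlyInverseʳ y))
    *w-injective : Injective _≡_ _≡_ λ i → to (from i * w)
    *w-injective {i} {j} eq = ≡.trans (≡.sym (strictlyInverseˡ i))
      (≡.trans (to-cong (cancel (to-injective eq))) (strictlyInverseˡ j))
    preimage = injective⇒surjective *w-injective (to 1#)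
    j = proj₁ preimage
    inv : from j * w ≈ 1#
    inv = to-injective (proj₂ preimage)

-- Characters of finite rings

at≉0 : ∀ {c ℓ} {G : RawGroup c ℓ} (χ : Character G) x → ¬ χ at x ≈ᶜ 0ᶜ
at≉0 χ x χx≈0 with ⟦ χ ⟧ x
... | z , w , _ , zw≈1 = 1≉0 (ℂR.trans (ℂR.sym zw≈1) (ℂR.trans (ℂR.*-congʳ χx≈0) (ℂR.zeroˡ w)))

module _ {c ℓ} (R : CommutativeRing c ℓ) (finite : IsFinite R) where
  open CommutativeRing R
  open AbelianGroup (unitGroup R) using (_∙_; _⁻¹; ε)
  open Inverse (proj₂ finite) using (to; from; strictlyInverseʳ)
  open UnitSum R finite
  open FiniteRing R finite
  open Ideal
  private
    module ≈ᶜ = SetoidReasoning ℂR.setoid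
    module ℂˣ = AbelianGroup ℂˣ

    fromℝ-cong : ∀ {x y} → x ≈ʳ y → fromℝ x ≈ᶜ fromℝ y
    fromℝ-cong x≈y = x≈y , ℝR.refl

    norm-cong : ∀ {z w} → z ≈ᶜ w → fromℝ ∣ z ∣² ≈ᶜ fromℝ ∣ w ∣²
    norm-cong = fromℝ-cong ∘ ∣∣²-cong

  additive-unimodular : ∀ (ψ : AdditiveCharacter R) x → ψ at x *ᶜ conj (ψ at x) ≈ᶜ 1ᶜ
  additive-unimodular ψ x = unimodular (λ i → ψ at from i) (ψ at x) (to 0#) (at≉0 ψ (from (to 0#))) (begin
    sum (λ i → norm (ψ at x *ᶜ ψ at from i))  ≈⟨ sum-cong-≋ (λ i → norm-cong (homo ψ x (from i))) ⟨
    sum (λ i → norm (ψ at (x + from i)))      ≈⟨ sum-reindex (λ y → norm (ψ at y)) (norm-cong ∘ ⟦⟧-cong ψ)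
                                                  (x +_) (- x +_) +-congˡ +-congˡ
                                                  (\\-leftDividesˡ x) (\\-leftDividesʳ x) ⟩
    sum (λ i → norm (ψ at from i))            ∎)
    where
    open ≈ᶜ
    open GroupProperties +-group using (\\-leftDividesˡ; \\-leftDividesʳ)
    norm = λ z → fromℝ ∣ z ∣²

  -- The family of values is indexed by all of R and is 0 off the units, so the nonzero entry that
  -- `unimodular` asks for is taken at 1.
  multiplicative-unimodular : ∀ (χ : MultiplicativeCharacter R) u → χ at u *ᶜ conj (χ at u) ≈ᶜ 1ᶜ
  multiplicative-unimodular χ u = unimodular (extend (χ at_) ∘ from) (χ at u) (to 1#)
    (λ eq → 1≉0 (ℂR.trans (ℂR.sym (extend-1 (invertible? R finite (from (to 1#))))) eq)) (begin
    sum (λ i → norm (χ at u *ᶜ extend (χ at_) (from i)))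
      ≈⟨ sum-cong-≋ (λ i → extendByZero-map (λ z → norm (χ at u *ᶜ z))
           (ℂR.trans (norm-cong (ℂR.zeroʳ (χ at u))) norm-0) (from i) (invertible? R finite (from i))) ⟨
    ∑ (λ v → norm (χ at u *ᶜ χ at v))
      ≈⟨ ∑-cong (λ v → norm-cong (homo χ u v)) ⟨
    ∑ (λ v → norm (χ at (u ∙ v)))
      ≈⟨ ∑-shift (λ v≈w → norm-cong (⟦⟧-cong χ v≈w)) u ⟩
    ∑ (λ v → norm (χ at v))
      ≈⟨ sum-cong-≋ (λ i → extendByZero-map norm norm-0 (from i) (invertible? R finite (from i))) ⟩
    sum (λ i → norm (extend (χ at_) (from i))) ∎)
    where
    open ≈ᶜ
    norm = λ z → fromℝ ∣ z ∣²
    norm-0 : norm 0ᶜ ≈ᶜ 0ᶜ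
    norm-0 = fromℝ-cong ∣0∣²≈0
    extend-1 : ∀ p → extendByZero R finite (χ at_) (from (to 1#)) p ≈ᶜ 1ᶜ
    extend-1 p = ℂR.trans
      (extendByZero-cong {χ at_} {χ at_} (⟦⟧-cong χ) (strictlyInverseʳ 1#) p (yes (proj₂ ε)))
      (ε-homo χ)

  conj-additive : ∀ (ψ : AdditiveCharacter R) x → conj (ψ at x) ≈ᶜ ψ at (- x)
  conj-additive ψ x = ℂR.trans
    (inverseʳ-unique (⟦ ψ ⟧ x) (conjˣ (⟦ ψ ⟧ x)) (additive-unimodular ψ x))
    (ℂR.sym (⁻¹-homo ψ x))
    where open GroupProperties ℂˣ.group using (inverseʳ-unique)

  -- Conjugate Kloosterman sums and vanishing of twisted Gauss sums

  module _ (ψ : AdditiveCharacter R) where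
    open CharacterSums R finite ψ

    -- Conjugation negates the argument of ψ, and u + a/u is an odd function of u. Inserting τ(-1)
    -- times its conjugate, which is 1, provides the factor that turns the conjugate of τ(u) into
    -- that of τ(-u); the substitution of -u for u then finishes.
    conj-kloosterman : ∀ τ a → conj (K τ a) ≈ᶜ τ at (-1ᵘ R) *ᶜ K (conjugate τ) a
    conj-kloosterman τ a@(a₀ , _) = begin
      conj (K τ a)
        ≈⟨ ℂR.*-identityˡ (conj (K τ a)) ⟨
      1ᶜ *ᶜ conj (K τ a)
        ≈⟨ ℂR.*-congʳ (multiplicative-unimodular τ (-1ᵘ R)) ⟨
      τ at (-1ᵘ R) *ᶜ conj (τ at (-1ᵘ R)) *ᶜ conj (K τ a)
        ≈⟨ ℂR.*-assoc (τ at (-1ᵘ R)) (τ̄ at (-1ᵘ R)) (conj (K τ a)) ⟩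
      τ at (-1ᵘ R) *ᶜ (τ̄ at (-1ᵘ R) *ᶜ conj (K τ a))
        ≈⟨ ℂR.*-congˡ negated ⟩
      τ at (-1ᵘ R) *ᶜ K τ̄ a ∎
      where
      open ≈ᶜ
      open RingProperties ring using (-1*x≈-x; -‿distribʳ-*)
      open AbelianGroupProperties +-abelianGroup using (⁻¹-∙-comm)
      τ̄ = conjugate τ
      arg : Unit R → Carrier
      arg u = proj₁ u + a₀ * proj₁ (u ⁻¹)
      arg-cong : ∀ {u v} → proj₁ u ≈ proj₁ v → arg u ≈ arg v
      arg-cong {u} {v} u≈v = +-cong u≈v (*-congˡ (AbelianGroup.⁻¹-cong (unitGroup R) {u} {v} u≈v))
      arg-neg : ∀ u → - arg u ≈ arg (-1ᵘ R ∙ u)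
      arg-neg u@(u₀ , u⁻¹ , _) = trans (sym (⁻¹-∙-comm u₀ (a₀ * u⁻¹)))
        (+-cong (sym (-1*x≈-x u₀)) (trans (-‿distribʳ-* a₀ u⁻¹) (*-congˡ (sym (-1*x≈-x u⁻¹)))))
      negated : τ̄ at (-1ᵘ R) *ᶜ conj (K τ a) ≈ᶜ K τ̄ a
      negated = begin
        τ̄ at (-1ᵘ R) *ᶜ conj (K τ a)
          ≈⟨ ℂR.*-congˡ (conj-∑ (λ u → τ at u *ᶜ ψ at arg u)) ⟩
        τ̄ at (-1ᵘ R) *ᶜ (∑ λ u → conj (τ at u *ᶜ ψ at arg u))
          ≈⟨ ∑-distribˡ (τ̄ at (-1ᵘ R)) (λ u → conj (τ at u *ᶜ ψ at arg u)) ⟩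
        (∑ λ u → τ̄ at (-1ᵘ R) *ᶜ conj (τ at u *ᶜ ψ at arg u))
          ≈⟨ ∑-cong (λ u → ℂR.trans
               (ℂR.*-congˡ (ℂR.trans (conj-* (τ at u) (ψ at arg u))
                 (ℂR.*-congˡ (ℂR.trans (conj-additive ψ (arg u)) (⟦⟧-cong ψ (arg-neg u))))))
               (ℂR.trans (ℂR.sym (ℂR.*-assoc (τ̄ at (-1ᵘ R)) (τ̄ at u) (ψ at arg (-1ᵘ R ∙ u))))
                 (ℂR.*-congʳ (ℂR.sym (homo τ̄ (-1ᵘ R) u))))) ⟩
        (∑ λ u → τ̄ at (-1ᵘ R ∙ u) *ᶜ ψ at arg (-1ᵘ R ∙ u))
          ≈⟨ ∑-shift (λ {u} {v} u≈v → ℂR.*-cong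
               (⟦⟧-cong τ̄ {u} {v} u≈v) (⟦⟧-cong ψ (arg-cong {u} {v} u≈v))) (-1ᵘ R) ⟩
        K τ̄ a ∎

    twistedGauss-nonunit : (local : IsLocal R) (χ : MultiplicativeCharacter R) →
      IsPrimitiveMultiplicative R local χ →
      ∀ w → ¬ Invertible _≈_ 1# _*_ w → twistedGauss χ w ≈ᶜ 0ᶜ
    twistedGauss-nonunit local χ (trivial⇒whole , conductor) w ¬unit = ≈0ᶜ-stable λ S≉0 →
      let
        fixed : ∀ t → proj₁ t * w ≈ w → χ at t ≈ᶜ 1ᶜ
        fixed t tw≈w = scaling≈1 S≉0 (ℂR.sym (ℂR.trans (twistedGauss-shift χ t w)
          (ℂR.*-congˡ (∑-cong λ b → ℂR.*-congˡ (⟦⟧-cong ψ (*-congˡ tw≈w))))))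
      in impossible fixed (_≈?_ R finite w 0#)
      where
      open IsLocal local renaming (maximalIdeal to M)
      ¬trivial : ¬ Trivial χ
      -- A trivial χ has conductor R; were that the zero ideal, R would be 0 and M would not be
      -- proper.
      ¬trivial trivial = proj₁ isMaximal λ x →
        respects M (sym (lower (trivial⇒whole trivial x))) (0∈ M)
      annihilator⊆M : ¬ w ≈ 0# → member (annihilator w) ⊆ member M
      annihilator⊆M w≉0 {x} (lift xw≈0) = nonunit∈maximal local λ (x⁻¹ , x⁻¹x≈1 , _) → w≉0
        (trans (sym (*-identityˡ w)) (trans (*-congʳ (sym x⁻¹x≈1))
          (trans (*-assoc x⁻¹ x w) (trans (*-congˡ xw≈0) (zeroʳ x⁻¹)))))
      impossible : (∀ t → proj₁ t * w ≈ w → χ at t ≈ᶜ 1ᶜ) → ¬ Dec (w ≈ 0#)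
      -- For w = 0 the annihilator is R, which is not inside M and cannot be compared with the
      -- conductor; but here every unit fixes w, so χ would be trivial.
      impossible fixed (yes w≈0) = ¬trivial λ t →
        fixed t (trans (*-congˡ w≈0) (trans (zeroʳ (proj₁ t)) (sym w≈0)))
      -- The conductor is the largest ideal of its kind, so Ann(w) lies in the zero ideal, and w
      -- would be a unit.
      impossible fixed (no w≉0) = ¬unit (regular⇒unit w (λ {x} →
        proj₂ (conductor ¬trivial) (annihilator w) (annihilator⊆M w≉0 , trivialOn1+) {x}))
        where
        trivialOn1+ : ∀ {x} → x ∈ member (annihilator w) → (u : Unit R) →
                      proj₁ u ≈ 1# + x → χ at u ≈ᶜ 1ᶜ
        trivialOn1+ {x} (lift xw≈0) u u≈1+x = fixed u (trans (*-congʳ u≈1+x)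
          (trans (distribʳ w 1# x) (trans (+-cong (*-identityˡ w) xw≈0) (+-identityʳ w))))

-- The twisted second moment of Kloosterman sums

mainTheorem8 : ∀ {c ℓ} (R : CommutativeRing c ℓ) (finite : IsFinite R) (local : IsLocal R) →
    IsFrobenius R →
    (ψ : AdditiveCharacter R) → IsPrimitiveAdditive R ψ →
    (τ χ : MultiplicativeCharacter R) → IsPrimitiveMultiplicative R local χ →
    ∑ˣ R finite (λ a → χ at a *ᶜ fromℝ ∣ kloosterman R finite ψ τ a ∣²)
    ≈ᶜ
    τ at (-1ᵘ R) *ᶜ jacobi R finite (χ · τ) (χ · conjugate τ)
    *ᶜ (gauss R finite ψ χ *ᶜ gauss R finite ψ χ)
mainTheorem8 R finite local _ ψ _ τ χ χ-primitive = begin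
  (∑ λ a → χ at a *ᶜ fromℝ ∣ K τ a ∣²)
    ≈⟨ ∑-cong (λ a → ℂR.trans
         (ℂR.*-congˡ (ℂR.trans (fromℝ-∣∣² (K τ a)) (ℂR.*-congˡ (conj-kloosterman R finite ψ τ a))))
         (pull (χ at a) (K τ a) (τ at (-1ᵘ R)) (K τ̄ a))) ⟩
  (∑ λ a → τ at (-1ᵘ R) *ᶜ (χ at a *ᶜ (K τ a *ᶜ K τ̄ a)))
    ≈⟨ ∑-distribˡ (τ at (-1ᵘ R)) (λ a → χ at a *ᶜ (K τ a *ᶜ K τ̄ a)) ⟨
  τ at (-1ᵘ R) *ᶜ (∑ λ a → χ at a *ᶜ (K τ a *ᶜ K τ̄ a))
    ≈⟨ ℂR.*-congˡ (kloosterman-product τ τ̄ χ (twistedGauss-nonunit R finite ψ local χ χ-primitive)) ⟩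
  τ at (-1ᵘ R) *ᶜ (G (χ · τ · τ̄) *ᶜ G χ *ᶜ J)
    ≈⟨ ℂR.*-congˡ (ℂR.*-congʳ (ℂR.*-congʳ (∑-cong λ u → ℂR.*-congˡ (χττ̄≈χ u)))) ⟩
  τ at (-1ᵘ R) *ᶜ (G χ *ᶜ G χ *ᶜ J)
    ≈⟨ ℂR.trans (ℂR.*-congˡ (ℂR.*-comm (G χ *ᶜ G χ) J))
                (ℂR.sym (ℂR.*-assoc (τ at (-1ᵘ R)) J (G χ *ᶜ G χ))) ⟩
  τ at (-1ᵘ R) *ᶜ J *ᶜ (G χ *ᶜ G χ) ∎
  where
  open SetoidReasoning ℂR.setoid
  open UnitSum R finite
  open CharacterSums R finite ψ
  τ̄ = conjugate τ
  J = jacobi R finite (χ · τ) (χ · τ̄)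
  pull : ∀ x y t z → x *ᶜ (y *ᶜ (t *ᶜ z)) ≈ᶜ t *ᶜ (x *ᶜ (y *ᶜ z))
  pull = solve 4 (λ x y t z → x ⊕ (y ⊕ (t ⊕ z)) ⊜ t ⊕ (x ⊕ (y ⊕ z))) ℂR.refl
    where open CommutativeMonoidSolver ℂR.*-commutativeMonoid using (solve; _⊜_; _⊕_)
  χττ̄≈χ : ∀ u → (χ · τ · τ̄) at u ≈ᶜ χ at u
  χττ̄≈χ u = ℂR.trans (ℂR.*-assoc (χ at u) (τ at u) (τ̄ at u))
    (ℂR.trans (ℂR.*-congˡ (multiplicative-unimodular R finite τ u)) (ℂR.*-identityʳ (χ at u)))
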